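{- Let $n,p$ be positive coprime integers. If $\omega,\omega'\in\widetilde{\mathfrak S}_n$ are dominant $p$-stable affine permutations with $t^p_{i,j}(\omega)=t^p_{i,j}(\omega')$ for all $i,j\in[n]$ with $i<j$, then $\omega=\omega'$. That is, each dominant $p$-stable affine permutation is determined uniquely by its rational Shi tableau.
   Context: The affine symmetric group $\widetilde{\mathfrak S}_n$ is the group of bijections $\omega:\mathbb Z\to\mathbb Z$ with $\omega(i+n)=\omega(i)+n$ for all $i$ and $\omega(1)+\dots+\omega(n)=n(n+1)/2$. An affine permutation $\omega$ is dominant if $\omega^{ -1}(1)<\omega^{ -1}(2)<\dots<\omega^{ -1}(n)$ (equivalently $\omega^{ -1}$ is the minimal length representative of its coset modulo the symmetric group $\mathfrak S_n$). It is $p$-stable if $\omega(i)<\omega(i+p)$ for all $i\in\mathbb Z$. For $i<j$ in $[n]$ set $k_{i,j}(\omega)=\left|\left\lfloor \frac{\omega^{ -1}(j)-\omega^{ -1}(i)}{n}\right\rfloor\right|$. Let $s\in\mathfrak S_n$ be the permutation with $s(i)\in[n]$ and $s(i)\equiv\omega^{ -1}(i)\pmod n$ for $i\in[n]$. For $n\ge2$ write $p=mn+r$ with $m\ge0$ and $r\in[n-1]$. The rational Shi tableau of a dominant $p$-stable $\omega$ is the collection of numbers, for $i<j$ in $[n]$: $t^p_{i,j}(\omega)=\min(k_{i,j}(\omega),m)$ if $r+s(i)<s(j)$ or $s(i)+r-n<s(j)<s(i)$, and $t^p_{i,j}(\omega)=\min(k_{i,j}(\omega),m+1)$ otherwise.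 (For $n=1$ the tableau is empty.) -}

module Defs where

open import Data.Nat as ℕ using (ℕ; zero; suc; NonZero)
open import Data.Integer as ℤ using (ℤ; +_; _-_; ∣_∣; _/ℕ_; _%ℕ_)
open import Data.List using (List; map; upTo)
open import Data.Product using (_×_)
open import Data.Bool using (if_then_else_; _∨_; _∧_)
open import Relation.Nullary using (does)
open import Data.Sum using (_⊎_)
open import Relation.Binary.PropositionalEquality using (_≡_)

sumℤ : List ℤ → ℤ
sumℤ = Data.List.foldr ℤ._+_ (+ 0)

record AffinePerm (n : ℕ) : Set where
  field
    ω        : ℤ → ℤ
    ωinv     : ℤ → ℤ
    inv-left  : ∀ i → ωinv (ω i) ≡ i
    inv-right : ∀ i → ω (ωinv i) ≡ i
    periodic  : ∀ i → ω (i ℤ.+ + n) ≡ ω i ℤ.+ + n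
    sum-cond  : sumℤ (map (λ k → ω (+ suc k)) (upTo n)) ≡ + ((n ℕ.* suc n) ℕ./ 2)
open AffinePerm public

Dominant : ∀ {n} → AffinePerm n → Set
Dominant {n} w = ∀ (i : ℕ) → 1 ℕ.≤ i → i ℕ.< n → ωinv w (+ i) ℤ.< ωinv w (+ suc i)

Stable : ∀ {n} → ℕ → AffinePerm n → Set
Stable p w = ∀ (i : ℤ) → ω w i ℤ.< ω w (i ℤ.+ + p)

module _ (n : ℕ) .{{_ : NonZero n}} where

  kij : AffinePerm n → ℕ → ℕ → ℕ
  kij w i j = ∣ (ωinv w (+ j) - ωinv w (+ i)) /ℕ n ∣

  -- s(i) ∈ [n] with s(i) ≡ ω⁻¹(i) (mod n)
  sω : AffinePerm n → ℕ → ℕ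
  sω w i = suc ((ωinv w (+ i) - + 1) %ℕ n)

  -- rational Shi tableau entry t^p_{i,j}(ω), with p = m n + r,
  -- m = ⌊p/n⌋, r = p mod n  (r ∈ [n-1] when n ≥ 2 and gcd(n,p) = 1)
  tp : ℕ → AffinePerm n → ℕ → ℕ → ℕ
  tp p w i j =
    if does (r ℕ.+ si ℕ.<? sj) ∨ (does ((+ si ℤ.+ + r ℤ.- + n) ℤ.<? + sj) ∧ does (sj ℕ.<? si))
    then ℕ._⊓_ (kij w i j) m
    else ℕ._⊓_ (kij w i j) (suc m)
    where
      m  = p ℕ./ n
      r  = p ℕ.% n
      si = sω w i
      sj = sω w j

{-# OPTIONS --safe #-}

-- Let A = {x : ω(x) ≥ 1}. Dominance and p-stability make A closed under adding n and p, with
-- minimal elements a_i = ω⁻¹(i) in their classes modulo n. The boundary of A is a lattice path whose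
-- vertices, one in each class modulo n + p, are joined by steps +p (north, n of them) and −n
-- (east, p of them). Sort the vertices by value. Counting elements of A in intervals of length p
-- shows that the column sums of the tableau give the ranks of the vertices with an outgoing north
-- step, and the row sums the ranks of those with an incoming north step. Among steps of the same
-- kind the order of the sources is the order of the targets, so the ranks visited by the path, and
-- the kinds of its steps, are determined. As p is invertible modulo n + p, the path runs through
-- all vertices, and so ω is determined up to translation. The sum condition fixes the translation.

module Submission where

open import Defs
open import Algebra.Properties.CommutativeSemigroup using (interchange)
open import Data.Bool using (Bool; true; false; not; _∧_; _∨_; if_then_else_)
open import Data.Bool.Properties using (∧-zeroʳ; ∧-identityʳ; ∨-identityʳ)
open import Data.Empty using (⊥-elim)
open import Data.Integer as ℤ using (ℤ; +_; -[1+_]; _+_; _-_; _*_; -_; ∣_∣; _/ℕ_; _%ℕ_)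
open import Data.Integer.DivMod using (n%ℕd<d; a≡a%ℕn+[a/ℕn]*n; 0≤n⇒0≤n/ℕd)
import Data.Integer.Properties as ℤₚ
open import Data.Integer.Tactic.RingSolver using (solve-∀)
open import Data.List using (applyUpTo)
open import Data.List.Properties using (map-upTo)
open import Data.Nat as ℕ using (ℕ; zero; suc; NonZero; _≤_; _<_; z≤n; s≤s)
open import Data.Nat.Coprimality using (Coprime; coprime-Bézout)
open import Data.Nat.GCD using (module Bézout)
import Data.Nat.Properties as ℕₚ
open import Data.Product using (∃; _×_; _,_; proj₁; proj₂)
open import Data.Sum using (_⊎_; inj₁; inj₂)
open import Function using (_∘_; mk⇔)
open import Relation.Binary.Definitions using (tri<; tri≈; tri>)
open import Relation.Binary.PropositionalEquality
open import Relation.Nullary using (¬_; Dec; yes; no; does)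
open import Relation.Nullary.Decidable using (dec-true; dec-false; does-⇔; _×-dec_; ¬?)

-- Integer inequalities as natural-number differences.

≤⇒∃ : ∀ {x y} → x ℤ.≤ y → ∃ λ k → y ≡ x + + k
≤⇒∃ {x} {y} x≤y = ∣ y - x ∣ ,
  trans (solve x y) (cong (λ z → x + z) (sym (ℤₚ.0≤i⇒+∣i∣≡i (ℤₚ.i≤j⇒0≤j-i x≤y))))
  where
  solve : ∀ x y → y ≡ x + (y - x)
  solve = solve-∀

<⇒∃ : ∀ {x y} → x ℤ.< y → ∃ λ k → y ≡ x + + suc k
<⇒∃ {x} x<y with ≤⇒∃ (ℤₚ.i<j⇒suc[i]≤j x<y)
... | k , refl = k , solve x (+ k)
  where
  solve : ∀ x k → + 1 + x + k ≡ x + (+ 1 + k)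
  solve = solve-∀

∃⇒< : ∀ x k → x ℤ.< x + + suc k
∃⇒< x k = ℤₚ.suc[i]≤j⇒i<j (subst (ℤ._≤ x + + suc k) (ℤₚ.+-comm x (+ 1)) (ℤₚ.+-monoʳ-≤ x (ℤ.+≤+ (s≤s z≤n))))

x-y+y : ∀ x y → x - y + y ≡ x
x-y+y = solve-∀

x+y-y : ∀ x y → x + y - y ≡ x
x+y-y = solve-∀

+-right-comm : ∀ x y z → x + y + z ≡ x + z + y
+-right-comm = solve-∀

true≢false : true ≢ false
true≢false ()

-- Finite sums and counting

∑ : ℕ → (ℕ → ℕ) → ℕ
∑ zero    g = 0
∑ (suc m) g = g 0 ℕ.+ ∑ m (g ∘ suc)

∑-cong : ∀ m {f g : ℕ → ℕ} → (∀ k → k < m → f k ≡ g k) → ∑ m f ≡ ∑ m g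
∑-cong zero    f≗g = refl
∑-cong (suc m) f≗g = cong₂ ℕ._+_ (f≗g 0 (s≤s z≤n)) (∑-cong m λ k k<m → f≗g (suc k) (s≤s k<m))

∑-last : ∀ m g → ∑ (suc m) g ≡ ∑ m g ℕ.+ g m
∑-last zero    g = ℕₚ.+-identityʳ (g 0)
∑-last (suc m) g = trans (cong (g 0 ℕ.+_) (∑-last m (g ∘ suc))) (sym (ℕₚ.+-assoc (g 0) _ _))

∑-zero : ∀ m → ∑ m (λ _ → 0) ≡ 0
∑-zero zero    = refl
∑-zero (suc m) = ∑-zero m

⟦_⟧ : Bool → ℕ
⟦ true  ⟧ = 1
⟦ false ⟧ = 0

⟦⟧≤1 : ∀ x → ⟦ x ⟧ ≤ 1
⟦⟧≤1 true  = ℕₚ.≤-refl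
⟦⟧≤1 false = z≤n

window : (ℤ → Bool) → ℕ → ℤ → ℕ
window A q x = ∑ q λ k → ⟦ A (x + + k) ⟧

window-cong : ∀ A q {x y} → x ≡ y → window A q x ≡ window A q y
window-cong A q = cong (window A q)

window-≤ : ∀ A q x → window A q x ≤ q
window-≤ A q x = go q (λ k → x + + k)
  where
  go : ∀ q (f : ℕ → ℤ) → ∑ q (λ k → ⟦ A (f k) ⟧) ≤ q
  go zero    f = z≤n
  go (suc q) f = ℕₚ.+-mono-≤ (⟦⟧≤1 (A (f 0))) (go q (f ∘ suc))

window-cons : ∀ A q x → window A (suc q) x ≡ ⟦ A x ⟧ ℕ.+ window A q (x + + 1)
window-cons A q x = cong₂ ℕ._+_ (cong (⟦_⟧ ∘ A) (ℤₚ.+-identityʳ x))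
  (∑-cong q λ k _ → cong (⟦_⟧ ∘ A) (sym (ℤₚ.+-assoc x (+ 1) (+ k))))

-- Both sides count the members among the `q + 1` integers from `x` on, split off at the left or at
-- the right end.
window-slide : ∀ A q x → ⟦ A x ⟧ ℕ.+ window A q (x + + 1) ≡ window A q x ℕ.+ ⟦ A (x + + q) ⟧
window-slide A q x = trans (sym (window-cons A q x)) (∑-last q _)

window-split : ∀ A q r x → window A (q ℕ.+ r) x ≡ window A q x ℕ.+ window A r (x + + q)
window-split A zero    r x = window-cong A r (sym (ℤₚ.+-identityʳ x))
window-split A (suc q) r x = begin
  window A (suc q ℕ.+ r) x                            ≡⟨ window-cons A (q ℕ.+ r) x ⟩
  a ℕ.+ window A (q ℕ.+ r) (x + + 1)                  ≡⟨ cong (a ℕ.+_) (window-split A q r (x + + 1)) ⟩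
  a ℕ.+ (window A q (x + + 1) ℕ.+ window A r (x + + 1 + + q)) ≡⟨ ℕₚ.+-assoc a _ _ ⟨
  a ℕ.+ window A q (x + + 1) ℕ.+ window A r (x + + 1 + + q)
    ≡⟨ cong₂ ℕ._+_ (sym (window-cons A q x)) (window-cong A r (ℤₚ.+-assoc x (+ 1) (+ q))) ⟩
  window A (suc q) x ℕ.+ window A r (x + + suc q)     ∎
  where
  open ≡-Reasoning
  a = ⟦ A x ⟧

-- Gaps of a set closed under adding `q`.

ClosedUnder : ℕ → (ℤ → Bool) → Set
ClosedUnder q A = ∀ x → A x ≡ true → A (x + + q) ≡ true

-- For closed `A` this is the last non-member of its class modulo `q`, so `x + + q` is the least
-- member of that class.
Gap : ℕ → (ℤ → Bool) → ℤ → Set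
Gap q A x = A x ≡ false × A (x + + q) ≡ true

module _ {q A} (closed : ClosedUnder q A) where

  -- Sliding by one loses `x` and gains `x + + q`; closure compensates every loss by a gain.
  window-step : ∀ x → window A q x ≤ window A q (x + + 1)
  window-step x with A x in e₀ | window-slide A q x
  ... | false | e rewrite e = ℕₚ.m≤m+n _ _
  ... | true  | e rewrite closed x e₀ =
    ℕₚ.≤-reflexive (sym (ℕₚ.suc-injective (trans e (ℕₚ.+-comm _ 1))))

  window-mono : ∀ {x y} → x ℤ.≤ y → window A q x ≤ window A q y
  window-mono {x} x≤y with ≤⇒∃ x≤y
  ... | k , refl = go k
    where
    go : ∀ k → window A q x ≤ window A q (x + + k)
    go zero    = ℕₚ.≤-reflexive (window-cong A q (sym (ℤₚ.+-identityʳ x)))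
    go (suc k) = ℕₚ.≤-trans (go k) (ℕₚ.≤-trans (window-step (x + + k))
      (ℕₚ.≤-reflexive (window-cong A q
        (trans (ℤₚ.+-assoc x (+ k) (+ 1)) (cong (λ m → x + + m) (ℕₚ.+-comm k 1))))))

  window-gap : ∀ {x} → Gap q A x → window A q (x + + 1) ≡ suc (window A q x)
  window-gap {x} (x∉ , x+q∈) with window-slide A q x
  ... | e rewrite x∉ | x+q∈ = trans e (ℕₚ.+-comm _ 1)

  window-strict : ∀ {x y} → Gap q A x → x ℤ.< y → window A q x < window A q y
  window-strict {x} {y} gap x<y = subst (_≤ window A q y) (window-gap gap)
    (window-mono (subst (ℤ._≤ y) (ℤₚ.+-comm (+ 1) x) (ℤₚ.i<j⇒suc[i]≤j x<y)))

  -- The count never falls and rises at each gap, so it serves as a rank that identifies gaps.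
  gap-injective : ∀ {x y} → Gap q A x → Gap q A y → window A q x ≡ window A q y → x ≡ y
  gap-injective {x} {y} gx gy e with ℤₚ.<-cmp x y
  ... | tri< x<y _ _ = ⊥-elim (ℕₚ.<-irrefl e (window-strict gx x<y))
  ... | tri≈ _ x≡y _ = x≡y
  ... | tri> _ _ y<x = ⊥-elim (ℕₚ.<-irrefl (sym e) (window-strict gy y<x))

  closed-iterate : ∀ k x → A x ≡ true → A (x + + k * + q) ≡ true
  closed-iterate zero    x x∈ = subst (λ y → A y ≡ true) (solve x (+ q)) x∈
    where
    solve : ∀ x q → x ≡ x + + 0 * q
    solve = solve-∀
  closed-iterate (suc k) x x∈ = subst (λ y → A y ≡ true) (solve x (+ k) (+ q))
    (closed _ (closed-iterate k x x∈))
    where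
    solve : ∀ x k q → x + k * q + q ≡ x + (+ 1 + k) * q
    solve = solve-∀

  gap-mod-≮ : ∀ x k → Gap q A x → ¬ Gap q A (x + + suc k * + q)
  gap-mod-≮ x k (_ , x+q∈) (y∉ , _) = true≢false
    (trans (sym (closed-iterate k _ x+q∈)) (trans (cong A (solve x (+ k) (+ q))) y∉))
    where
    solve : ∀ x k q → x + q + k * q ≡ x + (+ 1 + k) * q
    solve = solve-∀

  -- From `x + + q` on, the class of `x` lies in `A`, so no later point of the class is a gap. For
  -- negative `c` the two points exchange roles.
  gap-mod-injective : ∀ x c → Gap q A x → Gap q A (x + c * + q) → x + c * + q ≡ x
  gap-mod-injective x (+ zero)  gx gy = ℤₚ.+-identityʳ x
  gap-mod-injective x (+ suc k) gx gy = ⊥-elim (gap-mod-≮ x k gx gy)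
  gap-mod-injective x -[1+ k ]  gx gy = ⊥-elim
    (gap-mod-≮ _ k gy (subst (Gap q A) (solve x (+ suc k) (+ q)) gx))
    where
    solve : ∀ x k q → x ≡ x + (- k) * q + k * q
    solve = solve-∀

-- Subsets of ℤ closed under addition of n and of p

-- b lists the gaps of A with respect to n in increasing order.
record Semimodule (n p : ℕ) : Set where
  field
    A        : ℤ → Bool
    closed-n : ClosedUnder n A
    closed-p : ClosedUnder p A
    b        : ℕ → ℤ
    b-gap    : ∀ {i} → i < n → Gap n A (b i)
    gap⇒b    : ∀ {x} → Gap n A x → ∃ λ i → i < n × x ≡ b i
    b-rank   : ∀ {i} → i < n → window A n (b i) ≡ i

  -- The boundary lattice path of A visits one vertex in each residue class modulo p + n. From a
  -- vertex x it moves north to x + p if x + p ∉ A, and east to x − n otherwise.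
  Vertex : ℤ → Set
  Vertex = Gap (p ℕ.+ n) A

  -- The count goes up by one past each vertex and is otherwise constant, so it numbers the vertices
  -- in increasing order.
  rank : ℤ → ℕ
  rank = window A (p ℕ.+ n)

  closed-p+n : ClosedUnder (p ℕ.+ n) A
  closed-p+n x x∈ = subst (λ y → A y ≡ true) (ℤₚ.+-assoc x (+ p) (+ n)) (closed-n _ (closed-p x x∈))

  rank-pn : ∀ x → rank x ≡ window A p x ℕ.+ window A n (x + + p)
  rank-pn = window-split A p n

  rank-np : ∀ x → rank x ≡ window A n x ℕ.+ window A p (x + + n)
  rank-np x = trans (cong (λ q → window A q x) (ℕₚ.+-comm p n)) (window-split A n p x)

  -- The north steps run from `b i - + p` to `b i`: the target lies outside `A`, hence so does the
  -- source, by closure under `p`.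
  b-vertex : ∀ {i} → i < n → Vertex (b i - + p)
  b-vertex {i} i<n = b-p∉ , trans (cong A (solve (b i) (+ p) (+ n))) (proj₂ (b-gap i<n))
    where
    solve : ∀ b p n → b - p + (p + n) ≡ b + n
    solve = solve-∀
    b-p∉ : A (b i - + p) ≡ false
    b-p∉ with A (b i - + p) in e
    ... | false = refl
    ... | true  = trans (sym (closed-p _ e)) (trans (cong A (x-y+y (b i) (+ p))) (proj₁ (b-gap i<n)))

  -- Splitting the window after `p` terms leaves `window A n (b i)`, which is the index `i`.
  rank-b : ∀ {i} → i < n → rank (b i - + p) ≡ window A p (b i - + p) ℕ.+ i
  rank-b {i} i<n = trans (rank-pn (b i - + p)) (cong (window A p (b i - + p) ℕ.+_)
    (trans (window-cong A n (x-y+y (b i) (+ p))) (b-rank i<n)))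

-- Comparison of the boundary paths of two semimodules.

open Semimodule

-- `column` fixes the ranks of the sources of north steps and `row` the ranks of their targets,
-- because the rest of each rank is the index `i`.
record Agree {n p} (S T : Semimodule n p) : Set where
  field
    column : ∀ {i} → i < n → window (A S) p (b S i - + p) ≡ window (A T) p (b T i - + p)
    row    : ∀ {i} → i < n → window (A S) p (b S i + + n) ≡ window (A T) p (b T i + + n)

open Agree

Agree-sym : ∀ {n p} {S T : Semimodule n p} → Agree S T → Agree T S
Agree-sym ag = record { column = λ i<n → sym (column ag i<n) ; row = λ i<n → sym (row ag i<n) }

-- The generator of index window n x witnesses the strict inequality.
separate : ∀ {n p} (S T : Semimodule n p) x y → window (A S) n x < window (A T) n y →
  ∃ λ i → i < n × x ℤ.≤ b S i × b T i ℤ.< y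
separate {n} S T x y c<d = i , i<n , x≤b , b<y
  where
  i = window (A S) n x
  i<n : i < n
  i<n = ℕₚ.<-≤-trans c<d (window-≤ (A T) n y)
  x≤b : x ℤ.≤ b S i
  x≤b = ℤₚ.≮⇒≥ λ b<x → ℕₚ.<-irrefl (b-rank S i<n) (window-strict (closed-n S) (b-gap S i<n) b<x)
  b<y : b T i ℤ.< y
  b<y = ℤₚ.≰⇒> λ y≤b → ℕₚ.<⇒≱ c<d
    (subst (window (A T) n y ≤_) (b-rank T i<n) (window-mono (closed-n T) y≤b))

module _ {n p} {S T : Semimodule n p} (ag : Agree S T) where

  private
    LS = window (A S)
    LT = window (A T)

  -- `LS p x` counts the east sources before `x`, and `LS n (x + + p)` the north sources before it.
  -- If fewer north sources precede `x` than `y`, some north step `i` starts after `x` in `S` but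
  -- before `y` in `T`. By `column` the east count is then smaller too, against equality of the
  -- ranks.
  east-source-≮ : ∀ x y → Gap p (A S) x →
    LS p x ℕ.+ LS n (x + + p) ≡ LT p y ℕ.+ LT n (y + + p) → ¬ (LS n (x + + p) < LT n (y + + p))
  east-source-≮ x y gx e c<d with separate S T (x + + p) (y + + p) c<d
  ... | i , i<n , x+p≤b , b<y+p = ℕₚ.<-irrefl e (ℕₚ.+-mono-< p< c<d)
    where
    x<b-p : x ℤ.< b S i - + p
    x<b-p = subst (ℤ._< b S i - + p) (x+y-y x (+ p)) (ℤₚ.+-monoˡ-< (- + p)
      (ℤₚ.≤∧≢⇒< x+p≤b λ { e → true≢false (trans (sym (proj₂ gx)) (trans (cong (A S) e) (proj₁ (b-gap S i<n)))) }))
    b-p≤y : b T i - + p ℤ.≤ y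
    b-p≤y = subst (b T i - + p ℤ.≤_) (x+y-y y (+ p)) (ℤₚ.+-monoˡ-≤ (- + p) (ℤₚ.<⇒≤ b<y+p))
    p< : LS p x < LT p y
    p< = ℕₚ.<-≤-trans (window-strict (closed-p S) gx x<b-p)
      (ℕₚ.≤-trans (ℕₚ.≤-reflexive (column ag i<n)) (window-mono (closed-p T) b-p≤y))

  -- `LS n (x - + n)` counts the north targets below the east target `x - + n`. A north target lying
  -- above this east target in `S` but below the one in `T` would, by `row`, separate the equal
  -- counts `LS p x` and `LT p y`.
  east-target-≮ : ∀ x y → Gap p (A S) x → LS p x ≡ LT p y → ¬ (LS n (x - + n) < LT n (y - + n))
  east-target-≮ x y gx e c<d with separate S T (x - + n) (y - + n) c<d
  ... | i , i<n , x-n≤b , b<y-n = ℕₚ.<-irrefl e (ℕₚ.<-≤-trans (window-strict (closed-p S) gx x<b+n)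
      (ℕₚ.≤-trans (ℕₚ.≤-reflexive (row ag i<n)) (window-mono (closed-p T) b+n≤y)))
    where
    x-n≢b : x - + n ≢ b S i
    x-n≢b e = true≢false (trans (sym (proj₂ (b-gap S i<n)))
      (trans (cong (A S) (trans (cong (_+ + n) (sym e)) (x-y+y x (+ n)))) (proj₁ gx)))
    x<b+n : x ℤ.< b S i + + n
    x<b+n = subst (ℤ._< b S i + + n) (x-y+y x (+ n)) (ℤₚ.+-monoˡ-< (+ n) (ℤₚ.≤∧≢⇒< x-n≤b x-n≢b))
    b+n≤y : b T i + + n ℤ.≤ y
    b+n≤y = subst (b T i + + n ℤ.≤_) (x-y+y y (+ n)) (ℤₚ.+-monoˡ-≤ (+ n) (ℤₚ.<⇒≤ b<y-n))

  record Match (x y : ℤ) : Set where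
    field
      vertexˡ : Vertex S x
      vertexʳ : Vertex T y
      ranks   : rank S x ≡ rank T y

  open Match

  b-match : ∀ {i} → i < n → Match (b S i - + p) (b T i - + p)
  b-match i<n = record
    { vertexˡ = b-vertex S i<n
    ; vertexʳ = b-vertex T i<n
    ; ranks   = trans (rank-b S i<n) (trans (cong (ℕ._+ _) (column ag i<n)) (sym (rank-b T i<n)))
    }

  match-uniqueʳ : ∀ {x y y′} → Match x y → Match x y′ → y ≡ y′
  match-uniqueʳ M N = gap-injective (closed-p+n T) (vertexʳ M) (vertexʳ N) (trans (sym (ranks M)) (ranks N))

  match-uniqueˡ : ∀ {x x′ y} → Match x y → Match x′ y → x ≡ x′
  match-uniqueˡ M N = gap-injective (closed-p+n S) (vertexˡ M) (vertexˡ N) (trans (ranks M) (sym (ranks N)))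

-- Converse of `b-vertex`: here `x + + p` is a gap for `n`, and `gap⇒b` lists these.
vertex-north : ∀ {n p} (S : Semimodule n p) {x} → Vertex S x → A S (x + + p) ≡ false →
  ∃ λ i → i < n × x ≡ b S i - + p
vertex-north {n} {p} S {x} (_ , v) x+p∉ with gap⇒b S (x+p∉ , trans (cong (A S) (ℤₚ.+-assoc x (+ p) (+ n))) v)
... | i , i<n , e = i , i<n , trans (sym (x+y-y x (+ p))) (cong (_- + p) e)

module _ {n p} {S T : Semimodule n p} (ag : Agree S T) where

  open Match

  private
    LS = window (A S)
    LT = window (A T)

    north : ∀ {i} → i < n → Match ag (b S i - + p + + p) (b T i - + p + + p)
    north {i} i<n = subst₂ (Match ag) (sym (x-y+y (b S i) (+ p))) (sym (x-y+y (b T i) (+ p))) record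
      { vertexˡ = vertex S
      ; vertexʳ = vertex T
      ; ranks   = trans (rank-np S (b S i)) (trans (cong₂ ℕ._+_ (trans (b-rank S i<n) (sym (b-rank T i<n))) (row ag i<n))
                    (sym (rank-np T (b T i))))
      }
      where
      vertex : (R : Semimodule n p) → Vertex R (b R i)
      vertex R = proj₁ (b-gap R i<n) , trans (cong (A R) (solve (b R i) (+ p) (+ n))) (closed-p R _ (proj₂ (b-gap R i<n)))
        where
        solve : ∀ b p n → b + (p + n) ≡ b + n + p
        solve = solve-∀

    east-vertex : (R : Semimodule n p) → ∀ {x} → Gap p (A R) x → Vertex R (x - + n)
    east-vertex R {x} (x∉ , x+p∈) = x-n∉ , trans (cong (A R) (solve x (+ p) (+ n))) x+p∈
      where
      solve : ∀ x p n → x - n + (p + n) ≡ x + p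
      solve = solve-∀
      x-n∉ : A R (x - + n) ≡ false
      x-n∉ with A R (x - + n) in e
      ... | false = refl
      ... | true  = trans (sym (closed-n R _ e)) (trans (cong (A R) (x-y+y x (+ n))) x∉)

    -- Equal ranks split into equal north and east counts at the sources; equal east counts then
    -- give equal north counts at the targets. Each equality comes from excluding both strict
    -- inequalities, the second by exchanging `S` and `T`.
    east : ∀ {x y} → Match ag x y → Gap p (A S) x → Gap p (A T) y → Match ag (x - + n) (y - + n)
    east {x} {y} M gx gy = record
      { vertexˡ = east-vertex S gx
      ; vertexʳ = east-vertex T gy
      ; ranks   = begin
          rank S (x - + n)                             ≡⟨ rank-np S (x - + n) ⟩
          LS n (x - + n) ℕ.+ LS p (x - + n + + n)      ≡⟨ cong₂ ℕ._+_ target (window-cong (A S) p (x-y+y x (+ n))) ⟩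
          LT n (y - + n) ℕ.+ LS p x                    ≡⟨ cong (LT n (y - + n) ℕ.+_) source ⟩
          LT n (y - + n) ℕ.+ LT p y                    ≡⟨ cong (LT n (y - + n) ℕ.+_) (window-cong (A T) p (x-y+y y (+ n))) ⟨
          LT n (y - + n) ℕ.+ LT p (y - + n + + n)      ≡⟨ rank-np T (y - + n) ⟨
          rank T (y - + n)                             ∎
      }
      where
      open ≡-Reasoning
      e : LS p x ℕ.+ LS n (x + + p) ≡ LT p y ℕ.+ LT n (y + + p)
      e = trans (sym (rank-pn S x)) (trans (ranks M) (rank-pn T y))
      sourceₙ : LS n (x + + p) ≡ LT n (y + + p)
      sourceₙ with ℕₚ.<-cmp (LS n (x + + p)) (LT n (y + + p))
      ... | tri< c<d _ _ = ⊥-elim (east-source-≮ ag x y gx e c<d)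
      ... | tri≈ _ c≡d _ = c≡d
      ... | tri> _ _ d<c = ⊥-elim (east-source-≮ (Agree-sym ag) y x gy (sym e) d<c)
      source : LS p x ≡ LT p y
      source = ℕₚ.+-cancelʳ-≡ _ _ _ (trans e (cong (LT p y ℕ.+_) (sym sourceₙ)))
      target : LS n (x - + n) ≡ LT n (y - + n)
      target with ℕₚ.<-cmp (LS n (x - + n)) (LT n (y - + n))
      ... | tri< c<d _ _ = ⊥-elim (east-target-≮ ag x y gx source c<d)
      ... | tri≈ _ c≡d _ = c≡d
      ... | tri> _ _ d<c = ⊥-elim (east-target-≮ (Agree-sym ag) y x gy (sym source) d<c)

  -- Matched vertices take steps of the same kind: a vertex going north is some `b i - + p`, and its
  -- only match is the one of the same index.
  match-step : ∀ {x y} → Match ag x y →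
    Match ag (x + + p) (y + + p) ⊎ Match ag (x - + n) (y - + n)
  match-step {x} {y} M with A S (x + + p) in eS | A T (y + + p) in eT
  ... | true  | true  = inj₂ (east M (proj₁ (vertexˡ M) , eS) (proj₁ (vertexʳ M) , eT))
  ... | false | _     with vertex-north S (vertexˡ M) eS
  ...   | i , i<n , refl with match-uniqueʳ ag M (b-match ag i<n)
  ...     | refl = inj₁ (north i<n)
  match-step {x} {y} M | true | false with vertex-north T (vertexʳ M) eT
  ...   | i , i<n , refl with match-uniqueˡ ag M (b-match ag i<n)
  ...     | refl = inj₁ (north i<n)

  -- Both kinds of step add p modulo p + n.
  match-walk : ∀ {x y} → Match ag x y → ∀ k →
    ∃ λ c → Match ag (x + + k * + p + c * + (p ℕ.+ n)) (y + + k * + p + c * + (p ℕ.+ n))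
  match-walk {x} {y} M zero = + 0 , subst₂ (Match ag) (solve x (+ p) (+ n)) (solve y (+ p) (+ n)) M
    where
    solve : ∀ x p n → x ≡ x + + 0 * p + + 0 * (p + n)
    solve = solve-∀
  match-walk {x} {y} M (suc k) with match-walk M k
  ... | c , N with match-step N
  ...   | inj₁ N′ = c , subst₂ (Match ag) (solve x (+ k) c (+ p) (+ n)) (solve y (+ k) c (+ p) (+ n)) N′
    where
    solve : ∀ x k c p n → x + k * p + c * (p + n) + p ≡ x + (+ 1 + k) * p + c * (p + n)
    solve = solve-∀
  ...   | inj₂ N′ = c - + 1 , subst₂ (Match ag) (solve x (+ k) c (+ p) (+ n)) (solve y (+ k) c (+ p) (+ n)) N′
    where
    solve : ∀ x k c p n → x + k * p + c * (p + n) - n ≡ x + (+ 1 + k) * p + (c - + 1) * (p + n)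
    solve = solve-∀

-- Bézout coefficients and the walk through all residues modulo `p + n`.

bézout : ∀ {n p} → Coprime n p → ∃ λ u → ∃ λ v → u * + p + v * + n ≡ + 1
bézout {n} {p} cop with coprime-Bézout cop
... | Bézout.+- x y e = - + y , + x , trans (solve (+ y) (+ p) (+ x * + n)) (trans (cong (_- + y * + p) e′) (x+y-y (+ 1) (+ y * + p)))
  where
  solve : ∀ y p w → (- y) * p + w ≡ w - y * p
  solve = solve-∀
  e′ : + x * + n ≡ + 1 + + y * + p
  e′ = trans (sym (ℤₚ.pos-* x n)) (trans (cong +_ (sym e)) (cong (λ z → + 1 + z) (ℤₚ.pos-* y p)))
... | Bézout.-+ x y e = + y , - + x , trans (solve (+ x) (+ n) (+ y * + p)) (trans (cong (_- + x * + n) e′) (x+y-y (+ 1) (+ x * + n)))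
  where
  solve : ∀ x n w → w + (- x) * n ≡ w - x * n
  solve = solve-∀
  e′ : + y * + p ≡ + 1 + + x * + n
  e′ = trans (sym (ℤₚ.pos-* y p)) (trans (cong +_ (sym e)) (cong (λ z → + 1 + z) (ℤₚ.pos-* x n)))

residue-reachable : ∀ {n p} .{{_ : NonZero (p ℕ.+ n)}} → Coprime n p → ∀ d →
  ∃ λ k → ∃ λ c → d ≡ + k * + p + c * + (p ℕ.+ n)
residue-reachable {n} {p} cop d with bézout cop
... | u , v , uv = k , c , (begin
  d                                  ≡⟨ ℤₚ.*-identityʳ d ⟨
  d * + 1                            ≡⟨ cong (d *_) uv ⟨
  d * (u * + p + v * + n)            ≡⟨ solve₁ d u v (+ p) (+ n) ⟩
  e * + p + d * v * (+ p + + n)      ≡⟨ cong (λ z → z * + p + d * v * (+ p + + n)) (a≡a%ℕn+[a/ℕn]*n e (p ℕ.+ n)) ⟩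
  (+ k + q * (+ p + + n)) * + p + d * v * (+ p + + n) ≡⟨ solve₂ (+ k) q d v (+ p) (+ n) ⟩
  + k * + p + c * + (p ℕ.+ n)        ∎)
  where
  open ≡-Reasoning
  -- Modulo `p + n` the number `n` is congruent to `- p`, so `u - v` is an inverse of `p`. Reducing
  -- `e` gives a natural number of steps.
  e = d * (u - v)
  k = e %ℕ (p ℕ.+ n)
  q = e /ℕ (p ℕ.+ n)
  c = q * + p + d * v
  solve₁ : ∀ d u v p n → d * (u * p + v * n) ≡ d * (u - v) * p + d * v * (p + n)
  solve₁ = solve-∀
  solve₂ : ∀ k q d v p n → (k + q * (p + n)) * p + d * v * (p + n) ≡ k * p + (q * p + d * v) * (p + n)
  solve₂ = solve-∀

module _ {n p} {S T : Semimodule n p} (ag : Agree S T) where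

  open Match

  private
    P : ℤ
    P = + (p ℕ.+ n)

  -- After `k` steps from `b S 0 - + p` the path is in the class of `b S i - + p`, and a class holds
  -- only one vertex. The matched walk in `T` has undergone the same displacement and must have
  -- reached `b T i - + p`.
  b-translate : 0 < n → ∀ {i} → i < n → ∀ k c → b S i - b S 0 ≡ + k * + p + c * P →
    b T i ≡ b S i + (b T 0 - b S 0)
  b-translate 0<n {i} i<n k c e = reached (match-walk ag (b-match ag 0<n) k)
    where
    reached : (∃ λ c′ → Match ag (b S 0 - + p + + k * + p + c′ * P) (b T 0 - + p + + k * + p + c′ * P)) →
      b T i ≡ b S i + (b T 0 - b S 0)
    reached (c′ , M) = begin
      b T i                               ≡⟨ x-y+y (b T i) (+ p) ⟨
      b T i - + p + + p                   ≡⟨ cong (_+ + p) Y≡b ⟨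
      Y + + p                             ≡⟨ solve₂ (b S 0) (b T 0) (+ p) (+ k * + p) (c′ * P) ⟩
      X + + p + (b T 0 - b S 0)           ≡⟨ cong (λ x → x + + p + (b T 0 - b S 0)) X≡b ⟩
      b S i - + p + + p + (b T 0 - b S 0) ≡⟨ cong (_+ (b T 0 - b S 0)) (x-y+y (b S i) (+ p)) ⟩
      b S i + (b T 0 - b S 0)             ∎
      where
      open ≡-Reasoning
      X Y : ℤ
      X = b S 0 - + p + + k * + p + c′ * P
      Y = b T 0 - + p + + k * + p + c′ * P
      solve₁ : ∀ s p w c c′ P → s - p + w + c′ * P ≡ s + (w + c * P) - p + (c′ - c) * P
      solve₁ = solve-∀
      solve₂ : ∀ s t p w v → t - p + w + v + p ≡ s - p + w + v + p + (t - s)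
      solve₂ = solve-∀
      y-x : ∀ y x → x + (y - x) ≡ y
      y-x = solve-∀
      X≡ : X ≡ b S i - + p + (c′ - c) * P
      X≡ = begin
        X                                                          ≡⟨ solve₁ (b S 0) (+ p) (+ k * + p) c c′ P ⟩
        b S 0 + (+ k * + p + c * P) - + p + (c′ - c) * P           ≡⟨ cong (λ d → b S 0 + d - + p + (c′ - c) * P) e ⟨
        b S 0 + (b S i - b S 0) - + p + (c′ - c) * P               ≡⟨ cong (λ z → z - + p + (c′ - c) * P) (y-x (b S i) (b S 0)) ⟩
        b S i - + p + (c′ - c) * P                                 ∎
      X≡b : X ≡ b S i - + p
      X≡b = trans X≡ (gap-mod-injective (closed-p+n S) (b S i - + p) (c′ - c) (b-vertex S i<n)
        (subst (Vertex S) X≡ (vertexˡ M)))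
      Y≡b : Y ≡ b T i - + p
      Y≡b = match-uniqueʳ ag (subst (λ x → Match ag x Y) X≡b M) (b-match ag i<n)

  agree⇒translate : Coprime n p → ∀ {i} → i < n → b T i ≡ b S i + (b T 0 - b S 0)
  agree⇒translate cop {i} i<n = conclude (residue-reachable {n} {p} {{p+n≢0}} cop (b S i - b S 0))
    where
    0<n : 0 < n
    0<n = ℕₚ.≤-<-trans z≤n i<n
    p+n≢0 : NonZero (p ℕ.+ n)
    p+n≢0 = ℕ.>-nonZero (ℕₚ.<-≤-trans 0<n (ℕₚ.m≤n+m n p))
    conclude : (∃ λ k → ∃ λ c → b S i - b S 0 ≡ + k * + p + c * P) → b T i ≡ b S i + (b T 0 - b S 0)
    conclude (k , c , e) = b-translate 0<n i<n k c e

-- Double counting, and window counts between gaps.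

∑-+ : ∀ m f g → ∑ m (λ k → f k ℕ.+ g k) ≡ ∑ m f ℕ.+ ∑ m g
∑-+ zero    f g = refl
∑-+ (suc m) f g = trans (cong (f 0 ℕ.+ g 0 ℕ.+_) (∑-+ m (f ∘ suc) (g ∘ suc)))
  (interchange ℕₚ.+-commutativeSemigroup (f 0) (g 0) (∑ m (f ∘ suc)) (∑ m (g ∘ suc)))

∑-swap : ∀ m q (f : ℕ → ℕ → ℕ) → ∑ m (λ i → ∑ q (f i)) ≡ ∑ q (λ e → ∑ m (λ i → f i e))
∑-swap m zero    f = ∑-zero m
∑-swap m (suc q) f = trans (∑-+ m (λ i → f i 0) (λ i → ∑ q (f i ∘ suc)))
  (cong (∑ m (λ i → f i 0) ℕ.+_) (∑-swap m q (λ i → f i ∘ suc)))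

∑-indicator : ∀ n β c → c < n → ∑ n (λ i → ⟦ β ∧ does (c ℕ.≟ i) ⟧) ≡ ⟦ β ⟧
∑-indicator n       false c       _         = ∑-zero n
∑-indicator (suc n) true  zero    _         = cong suc (∑-zero n)
∑-indicator (suc n) true  (suc c) (s≤s c<n) = ∑-indicator n true c c<n

∑-by-class : ∀ n q (B : ℕ → Bool) (c : ℕ → ℕ) → (∀ e → c e < n) →
  ∑ q (λ e → ⟦ B e ⟧) ≡ ∑ n (λ i → ∑ q (λ e → ⟦ B e ∧ does (c e ℕ.≟ i) ⟧))
∑-by-class n q B c c<n = trans (∑-cong q λ e _ → sym (∑-indicator n (B e) (c e) (c<n e))) (sym (∑-swap n q _))

∑-not : ∀ q (B : ℕ → Bool) → ∑ q (λ e → ⟦ B e ⟧) ℕ.+ ∑ q (λ e → ⟦ not (B e) ⟧) ≡ q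
∑-not q B = trans (sym (∑-+ q _ _)) (trans (∑-cong q λ e _ → one (B e)) (∑-one q))
  where
  one : ∀ x → ⟦ x ⟧ ℕ.+ ⟦ not x ⟧ ≡ 1
  one true  = refl
  one false = refl
  ∑-one : ∀ q → ∑ q (λ _ → 1) ≡ q
  ∑-one zero    = refl
  ∑-one (suc q) = cong suc (∑-one q)

-- Reading the window from its upper end makes `suc e` the distance below `c`, as needed to match
-- `e` with the residues in a tableau column.
window-down : ∀ A q c → window A q (c - + q) ≡ ∑ q (λ e → ⟦ A (c - + suc e) ⟧)
window-down A zero    c = refl
window-down A (suc q) c = begin
  window A (suc q) (c - + suc q)                             ≡⟨ window-cons A q (c - + suc q) ⟩
  a ℕ.+ window A q (c - + suc q + + 1)                       ≡⟨ cong (a ℕ.+_) (window-cong A q (solve c (+ q))) ⟩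
  a ℕ.+ window A q (c - + q)                                 ≡⟨ cong (a ℕ.+_) (window-down A q c) ⟩
  a ℕ.+ ∑ q (λ e → ⟦ A (c - + suc e) ⟧)                      ≡⟨ ℕₚ.+-comm a _ ⟩
  ∑ q (λ e → ⟦ A (c - + suc e) ⟧) ℕ.+ a                      ≡⟨ ∑-last q _ ⟨
  ∑ (suc q) (λ e → ⟦ A (c - + suc e) ⟧)                      ∎
  where
  open ≡-Reasoning
  a = ⟦ A (c - + suc q) ⟧
  solve : ∀ c q → c - (+ 1 + q) + + 1 ≡ c - q
  solve = solve-∀

window-no-gap : ∀ A q x → ClosedUnder q A → ¬ Gap q A x → window A q (x + + 1) ≡ window A q x
window-no-gap A q x closed ¬gap with A x in e₀ | A (x + + q) in e₁ | window-slide A q x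
... | true  | true  | e = ℕₚ.suc-injective (trans e (ℕₚ.+-comm _ 1))
... | true  | false | _ = ⊥-elim (true≢false (trans (sym (closed x e₀)) e₁))
... | false | true  | _ = ⊥-elim (¬gap (refl , refl))
... | false | false | e = trans e (ℕₚ.+-identityʳ _)

-- Carries the count from just after one generator to the next.
window-no-gaps : ∀ A q x → ClosedUnder q A → ∀ k → (∀ m → m < k → ¬ Gap q A (x + + m)) →
  window A q (x + + k) ≡ window A q x
window-no-gaps A q x closed zero    _    = window-cong A q (ℤₚ.+-identityʳ x)
window-no-gaps A q x closed (suc k) none = begin
  window A q (x + + suc k)   ≡⟨ window-cong A q (solve x (+ k)) ⟩
  window A q (x + + k + + 1) ≡⟨ window-no-gap A q (x + + k) closed (none k ℕₚ.≤-refl) ⟩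
  window A q (x + + k)       ≡⟨ window-no-gaps A q x closed k (λ m m<k → none m (ℕₚ.m<n⇒m<1+n m<k)) ⟩
  window A q x               ∎
  where
  open ≡-Reasoning
  solve : ∀ x k → x + (+ 1 + k) ≡ x + k + + 1
  solve = solve-∀

-- Division with remainder

remainder-≮ : ∀ n {r r′} q q′ → r < n → + r + q * + n ≡ + r′ + q′ * + n → ¬ (q ℤ.< q′)
remainder-≮ n {r} {r′} q q′ r<n e q<q′ with <⇒∃ q<q′
... | k , refl = ℕₚ.<⇒≱ r<n (subst (n ≤_) (sym r≡) (ℕₚ.≤-trans (ℕₚ.m≤m+n n (k ℕ.* n)) (ℕₚ.m≤n+m _ r′)))
  where
  solve₁ : ∀ r q n → r ≡ r + q * n - q * n
  solve₁ = solve-∀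
  solve₂ : ∀ r q k n → r + (q + k) * n - q * n ≡ r + k * n
  solve₂ = solve-∀
  r≡ : r ≡ r′ ℕ.+ suc k ℕ.* n
  r≡ = ℤₚ.+-injective (begin
    + r                                      ≡⟨ solve₁ (+ r) q (+ n) ⟩
    + r + q * + n - q * + n                  ≡⟨ cong (_- q * + n) e ⟩
    + r′ + (q + + suc k) * + n - q * + n     ≡⟨ solve₂ (+ r′) q (+ suc k) (+ n) ⟩
    + r′ + + suc k * + n                     ≡⟨ cong (λ z → + r′ + z) (ℤₚ.pos-* (suc k) n) ⟨
    + (r′ ℕ.+ suc k ℕ.* n)                   ∎)
    where open ≡-Reasoning

divMod-unique : ∀ n {r r′} q q′ → r < n → r′ < n → + r + q * + n ≡ + r′ + q′ * + n → r ≡ r′ × q ≡ q′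
divMod-unique n {r} {r′} q q′ r<n r′<n e with ℤₚ.<-cmp q q′
... | tri< q<q′ _ _ = ⊥-elim (remainder-≮ n q q′ r<n e q<q′)
... | tri> _ _ q′<q = ⊥-elim (remainder-≮ n q′ q r′<n (sym e) q′<q)
... | tri≈ _ refl _ = ℤₚ.+-injective (trans (sym (x+y-y (+ r) (q * + n))) (trans (cong (_- q * + n) e) (x+y-y (+ r′) (q * + n)))) , refl

divMod-≡ : ∀ n .{{_ : NonZero n}} x {r} q → r < n → x ≡ + r + q * + n → x %ℕ n ≡ r × x /ℕ n ≡ q
divMod-≡ n x q r<n e = divMod-unique n (x /ℕ n) q (n%ℕd<d x n) r<n (trans (sym (a≡a%ℕn+[a/ℕn]*n x n)) e)

module _ (n : ℕ) .{{_ : NonZero n}} {D} (D<n : D < n) where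

  private
    -- Closed form for the number of `e < p` congruent to `D` modulo `n`.
    ResidueCount : ℕ → ℕ
    ResidueCount p = p ℕ./ n ℕ.+ ⟦ does (D ℕ.<? p ℕ.% n) ⟧

    decomp : ∀ p → + p ≡ + (p ℕ.% n) + + (p ℕ./ n) * + n
    decomp p = a≡a%ℕn+[a/ℕn]*n (+ p) n

    suc-divMod : ∀ p → (suc (p ℕ.% n) < n × suc p ℕ.% n ≡ suc (p ℕ.% n) × suc p ℕ./ n ≡ p ℕ./ n)
                     ⊎ (suc (p ℕ.% n) ≡ n × suc p ℕ.% n ≡ 0 × suc p ℕ./ n ≡ suc (p ℕ./ n))
    suc-divMod p with ℕₚ.m≤n⇒m<n∨m≡n (n%ℕd<d (+ p) n)
    ... | inj₁ lt = inj₁ (lt , proj₁ dm , ℤₚ.+-injective (proj₂ dm))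
      where
      dm = divMod-≡ n (+ suc p) (+ (p ℕ./ n)) lt (trans (cong (λ z → + 1 + z) (decomp p))
        (sym (ℤₚ.+-assoc (+ 1) (+ (p ℕ.% n)) (+ (p ℕ./ n) * + n))))
    ... | inj₂ eq = inj₂ (eq , proj₁ dm , ℤₚ.+-injective (proj₂ dm))
      where
      solve : ∀ r q n → + 1 + r ≡ n → + 1 + (r + q * n) ≡ + 0 + (+ 1 + q) * n
      solve r q _ refl = go r q
        where
        go : ∀ r q → + 1 + (r + q * (+ 1 + r)) ≡ + 0 + (+ 1 + q) * (+ 1 + r)
        go = solve-∀
      dm = divMod-≡ n (+ suc p) (+ suc (p ℕ./ n)) (ℕₚ.≤-<-trans z≤n D<n)
        (trans (cong (λ z → + 1 + z) (decomp p)) (solve (+ (p ℕ.% n)) (+ (p ℕ./ n)) (+ n) (cong +_ eq)))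

    residueCount-hit : ∀ p → p ℕ.% n ≡ D → ResidueCount p ≡ p ℕ./ n
    residueCount-hit p e = trans (cong (λ β → p ℕ./ n ℕ.+ ⟦ β ⟧) (dec-false (D ℕ.<? p ℕ.% n) (ℕₚ.<-irrefl (sym e))))
      (ℕₚ.+-identityʳ _)

    -- When `p` hits the residue, the indicator switches on or, on a carry, the quotient grows. On
    -- any other carry the quotient gains what the indicator loses.
    residueCount-suc : ∀ p → ResidueCount (suc p) ≡ ResidueCount p ℕ.+ ⟦ does (p ℕ.% n ℕ.≟ D) ⟧
    residueCount-suc p = by-cases (suc-divMod p) (p ℕ.% n ℕ.≟ D)
      where
      value : ∀ m r {β} → suc p ℕ./ n ≡ m → suc p ℕ.% n ≡ r → does (D ℕ.<? r) ≡ β → ResidueCount (suc p) ≡ m ℕ.+ ⟦ β ⟧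
      value _ _ refl refl refl = refl
      valueₚ : ∀ {β} → does (D ℕ.<? p ℕ.% n) ≡ β → ResidueCount p ≡ p ℕ./ n ℕ.+ ⟦ β ⟧
      valueₚ refl = refl
      by-cases : _ → (d : Dec (p ℕ.% n ≡ D)) → ResidueCount (suc p) ≡ ResidueCount p ℕ.+ ⟦ does d ⟧
      by-cases (inj₁ (_ , er , em)) (yes e) = trans
        (value _ _ em er (dec-true (D ℕ.<? suc (p ℕ.% n)) (s≤s (ℕₚ.≤-reflexive (sym e)))))
        (cong (ℕ._+ 1) (sym (residueCount-hit p e)))
      by-cases (inj₂ (_ , er , em)) (yes e) = trans
        (value _ _ em er (dec-false (D ℕ.<? 0) λ ()))
        (trans (ℕₚ.+-identityʳ _) (trans (ℕₚ.+-comm 1 _) (cong (ℕ._+ 1) (sym (residueCount-hit p e)))))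
      by-cases (inj₁ (_ , er , em)) (no ¬e) = trans (value _ _ em er
        (does-⇔ (mk⇔ (λ { (s≤s D≤) → ℕₚ.≤∧≢⇒< D≤ (¬e ∘ sym) }) ℕₚ.m<n⇒m<1+n) (D ℕ.<? suc (p ℕ.% n)) (D ℕ.<? p ℕ.% n)))
        (sym (ℕₚ.+-identityʳ _))
      by-cases (inj₂ (en , er , em)) (no ¬e) = trans (value _ _ em er (dec-false (D ℕ.<? 0) λ ()))
        (trans (ℕₚ.+-identityʳ _) (trans (ℕₚ.+-comm 1 _) (sym (trans (ℕₚ.+-identityʳ _)
          (valueₚ (dec-true (D ℕ.<? p ℕ.% n) (ℕₚ.≤∧≢⇒< (ℕₚ.≤-pred (subst (D <_) (sym en) D<n)) (¬e ∘ sym))))))))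

  -- The `e` with remainder `D` have quotients 0, 1, 2 and so on, so bounding the quotient keeps the
  -- first `k` of them. This is the minimum in a tableau entry.
  residue-count : ∀ p k → ∑ p (λ e → ⟦ does (e ℕ./ n ℕ.<? k) ∧ does (e ℕ.% n ℕ.≟ D) ⟧) ≡
    k ℕ.⊓ (p ℕ./ n ℕ.+ ⟦ does (D ℕ.<? p ℕ.% n) ⟧)
  residue-count zero    k = sym (trans (cong (k ℕ.⊓_) zero-count) (ℕₚ.⊓-zeroʳ k))
    where
    dm = divMod-≡ n (+ 0) (+ 0) (ℕₚ.≤-<-trans z≤n D<n) refl
    zero-count : ResidueCount 0 ≡ 0
    zero-count = cong₂ (λ m β → m ℕ.+ ⟦ β ⟧) (ℤₚ.+-injective (proj₂ dm))
      (dec-false (D ℕ.<? 0 ℕ.% n) λ D<0 → ℕₚ.n≮0 (subst (D <_) (proj₁ dm) D<0))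
  residue-count (suc p) k = trans (∑-last p _) (trans (cong (ℕ._+ ⟦ does (p ℕ./ n ℕ.<? k) ∧ does (p ℕ.% n ℕ.≟ D) ⟧) (residue-count p k))
    (trans (step (p ℕ.% n ℕ.≟ D)) (cong (k ℕ.⊓_) (sym (residueCount-suc p)))))
    where
    ⊓-suc : ∀ m (d : Dec (m < k)) → k ℕ.⊓ m ℕ.+ ⟦ does d ∧ true ⟧ ≡ k ℕ.⊓ (m ℕ.+ 1)
    ⊓-suc m (yes m<k) = trans (cong (ℕ._+ 1) (ℕₚ.m≥n⇒m⊓n≡n (ℕₚ.<⇒≤ m<k)))
      (sym (ℕₚ.m≥n⇒m⊓n≡n (subst (_≤ k) (ℕₚ.+-comm 1 m) m<k)))
    ⊓-suc m (no m≮k) = trans (ℕₚ.+-identityʳ _) (trans (ℕₚ.m≤n⇒m⊓n≡m (ℕₚ.≮⇒≥ m≮k))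
      (sym (ℕₚ.m≤n⇒m⊓n≡m (ℕₚ.≤-trans (ℕₚ.≮⇒≥ m≮k) (ℕₚ.m≤m+n m 1)))))
    step : (d : Dec (p ℕ.% n ≡ D)) →
      k ℕ.⊓ ResidueCount p ℕ.+ ⟦ does (p ℕ./ n ℕ.<? k) ∧ does d ⟧ ≡ k ℕ.⊓ (ResidueCount p ℕ.+ ⟦ does d ⟧)
    step (no  _) = trans (cong (λ β → k ℕ.⊓ ResidueCount p ℕ.+ ⟦ β ⟧) (∧-zeroʳ (does (p ℕ./ n ℕ.<? k))))
      (trans (ℕₚ.+-identityʳ _) (cong (k ℕ.⊓_) (sym (ℕₚ.+-identityʳ _))))
    step (yes e) = subst
      (λ m → k ℕ.⊓ m ℕ.+ ⟦ does (p ℕ./ n ℕ.<? k) ∧ true ⟧ ≡ k ℕ.⊓ (m ℕ.+ 1))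
      (sym (residueCount-hit p e)) (⊓-suc (p ℕ./ n) (p ℕ./ n ℕ.<? k))

-- suc D is the residue of ω⁻¹(j) − ω⁻¹(i), and s, t are s(i), s(j).

cap-condition : ∀ n r s t D → (t ≡ s ℕ.+ suc D ⊎ (t < s × t ℕ.+ n ≡ s ℕ.+ suc D)) →
  does (r ℕ.+ s ℕ.<? t) ∨ (does ((+ s + + r - + n) ℤ.<? + t) ∧ does (t ℕ.<? s)) ≡ not (does (D ℕ.<? r))
-- Without wrap-around the second disjunct fails, as `t` exceeds `s`, and the first says
-- `r < suc D`.
cap-condition n r s _ D (inj₁ refl) = trans (cong₂ _∨_ first second) (∨-identityʳ _)
  where
  second : does ((+ s + + r - + n) ℤ.<? + (s ℕ.+ suc D)) ∧ does (s ℕ.+ suc D ℕ.<? s) ≡ false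
  second = trans (cong (does ((+ s + + r - + n) ℤ.<? + (s ℕ.+ suc D)) ∧_)
    (dec-false (s ℕ.+ suc D ℕ.<? s) (ℕₚ.m+n≮m s (suc D)))) (∧-zeroʳ _)
  first : does (r ℕ.+ s ℕ.<? s ℕ.+ suc D) ≡ not (does (D ℕ.<? r))
  first = does-⇔ (mk⇔
    (λ lt → ℕₚ.≤⇒≯ (ℕₚ.≤-pred (ℕₚ.+-cancelˡ-< s r (suc D) (subst (_< s ℕ.+ suc D) (ℕₚ.+-comm r s) lt))))
    (λ D≮r → subst (_< s ℕ.+ suc D) (ℕₚ.+-comm s r) (ℕₚ.+-monoʳ-< s (s≤s (ℕₚ.≮⇒≥ D≮r)))))
    (r ℕ.+ s ℕ.<? s ℕ.+ suc D) (¬? (D ℕ.<? r))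
-- With wrap-around the first disjunct fails, and adding `n` to both sides turns the integer
-- inequality into `r < suc D`.
cap-condition n r s t D (inj₂ (t<s , e)) = trans
  (cong₂ _∨_ (dec-false (r ℕ.+ s ℕ.<? t) λ lt → ℕₚ.<-asym t<s (ℕₚ.≤-<-trans (ℕₚ.m≤n+m s r) lt))
             (trans (cong (does ((+ s + + r - + n) ℤ.<? + t) ∧_) (dec-true (t ℕ.<? s) t<s)) (∧-identityʳ _)))
  (does-⇔ (mk⇔
    (λ lt → ℕₚ.≤⇒≯ (ℕₚ.≤-pred (ℕₚ.+-cancelˡ-< s r (suc D) (ℤₚ.drop‿+<+
      (subst₂ ℤ._<_ (x-y+y (+ s + + r) (+ n)) (cong +_ e) (ℤₚ.+-monoˡ-< (+ n) lt))))))
    (λ D≮r → subst₂ ℤ._<_ refl (trans (cong (λ z → + z - + n) (sym e)) (x+y-y (+ t) (+ n)))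
      (ℤₚ.+-monoˡ-< (- + n) (ℤ.+<+ (ℕₚ.+-monoʳ-< s (s≤s (ℕₚ.≮⇒≥ D≮r)))))))
    ((+ s + + r - + n) ℤ.<? + t) (¬? (D ℕ.<? r)))

does-true⇒ : ∀ {P : Set} (d : Dec P) → does d ≡ true → P
does-true⇒ (yes p) _ = p

does-false⇒ : ∀ {P : Set} (d : Dec P) → does d ≡ false → ¬ P
does-false⇒ (no ¬p) _ = ¬p

-- The semimodule of an affine permutation

module Perm {n} .{{n≢0 : NonZero n}} (w : AffinePerm n) where

  0<n : 0 < n
  0<n = ℕ.>-nonZero⁻¹ n

  ω-shift-ℕ : ∀ x k → ω w (x + + k * + n) ≡ ω w x + + k * + n
  ω-shift-ℕ x zero    = trans (cong (ω w) (ℤₚ.+-identityʳ x)) (sym (ℤₚ.+-identityʳ (ω w x)))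
  ω-shift-ℕ x (suc k) = begin
    ω w (x + + suc k * + n)     ≡⟨ cong (ω w) (solve x (+ k) (+ n)) ⟩
    ω w (x + + k * + n + + n)   ≡⟨ periodic w (x + + k * + n) ⟩
    ω w (x + + k * + n) + + n   ≡⟨ cong (_+ + n) (ω-shift-ℕ x k) ⟩
    ω w x + + k * + n + + n     ≡⟨ solve (ω w x) (+ k) (+ n) ⟨
    ω w x + + suc k * + n       ∎
    where
    open ≡-Reasoning
    solve : ∀ x k n → x + (+ 1 + k) * n ≡ x + k * n + n
    solve = solve-∀

  ω-shift : ∀ x l → ω w (x + l * + n) ≡ ω w x + l * + n
  ω-shift x (+ k)    = ω-shift-ℕ x k
  ω-shift x -[1+ k ] = begin
    ω w y                                          ≡⟨ x+y-y (ω w y) (+ suc k * + n) ⟨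
    ω w y + + suc k * + n - + suc k * + n          ≡⟨ cong (_- + suc k * + n) (ω-shift-ℕ y (suc k)) ⟨
    ω w (y + + suc k * + n) - + suc k * + n        ≡⟨ cong (λ z → ω w z - + suc k * + n) (solve₁ x (+ suc k) (+ n)) ⟩
    ω w x - + suc k * + n                          ≡⟨ solve₂ (ω w x) (+ suc k) (+ n) ⟩
    ω w x + -[1+ k ] * + n                         ∎
    where
    open ≡-Reasoning
    y = x + -[1+ k ] * + n
    solve₁ : ∀ x k n → x + (- k) * n + k * n ≡ x
    solve₁ = solve-∀
    solve₂ : ∀ x k n → x - k * n ≡ x + (- k) * n
    solve₂ = solve-∀

  ωinv-shift : ∀ y l → ωinv w (y + l * + n) ≡ ωinv w y + l * + n
  ωinv-shift y l = begin
    ωinv w (y + l * + n)                   ≡⟨ cong (λ z → ωinv w (z + l * + n)) (inv-right w y) ⟨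
    ωinv w (ω w (ωinv w y) + l * + n)      ≡⟨ cong (ωinv w) (ω-shift (ωinv w y) l) ⟨
    ωinv w (ω w (ωinv w y + l * + n))      ≡⟨ inv-left w _ ⟩
    ωinv w y + l * + n                     ∎
    where open ≡-Reasoning

  -- Indexed from zero, so that the indices are the remainders `cls`. This is the least member of
  -- its class modulo `n`.
  a : ℕ → ℤ
  a i = ωinv w (+ suc i)

  cls : ℤ → ℕ
  cls y = (ω w y - + 1) %ℕ n

  quo : ℤ → ℤ
  quo y = (ω w y - + 1) /ℕ n

  cls<n : ∀ y → cls y < n
  cls<n y = n%ℕd<d (ω w y - + 1) n

  ω-divMod : ∀ y → ω w y - + 1 ≡ + cls y + quo y * + n
  ω-divMod y = a≡a%ℕn+[a/ℕn]*n (ω w y - + 1) n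

  y≡a+quo*n : ∀ y → y ≡ a (cls y) + quo y * + n
  y≡a+quo*n y = begin
    y                                      ≡⟨ inv-left w y ⟨
    ωinv w (ω w y)                         ≡⟨ cong (ωinv w) (solve (ω w y)) ⟩
    ωinv w (+ 1 + (ω w y - + 1))           ≡⟨ cong (λ z → ωinv w (+ 1 + z)) (ω-divMod y) ⟩
    ωinv w (+ 1 + (+ cls y + quo y * + n)) ≡⟨ cong (ωinv w) (ℤₚ.+-assoc (+ 1) (+ cls y) (quo y * + n)) ⟨
    ωinv w (+ suc (cls y) + quo y * + n)   ≡⟨ ωinv-shift (+ suc (cls y)) (quo y) ⟩
    a (cls y) + quo y * + n                ∎
    where
    open ≡-Reasoning
    solve : ∀ x → x ≡ + 1 + (x - + 1)
    solve = solve-∀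

  -- `ω` sends `a i + l * + n` to `+ suc i + l * + n`, from which remainder and quotient can be read
  -- off.
  cls-quo-unique : ∀ {i y} l → i < n → y ≡ a i + l * + n → cls y ≡ i × quo y ≡ l
  cls-quo-unique {i} {y} l i<n e = divMod-≡ n (ω w y - + 1) l i<n (begin
    ω w y - + 1                 ≡⟨ cong (λ z → ω w z - + 1) e ⟩
    ω w (a i + l * + n) - + 1   ≡⟨ cong (_- + 1) (ω-shift (a i) l) ⟩
    ω w (a i) + l * + n - + 1   ≡⟨ cong (λ z → z + l * + n - + 1) (inv-right w (+ suc i)) ⟩
    + suc i + l * + n - + 1     ≡⟨ solve (+ i) (l * + n) ⟩
    + i + l * + n               ∎)
    where
    open ≡-Reasoning
    solve : ∀ i m → + 1 + i + m - + 1 ≡ i + m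
    solve = solve-∀

  quo-shift : ∀ y → quo (y + + n) ≡ quo y + + 1
  quo-shift y = proj₂ (cls-quo-unique (quo y + + 1) (cls<n y)
    (trans (cong (_+ + n) (y≡a+quo*n y)) (solve (a (cls y)) (quo y) (+ n))))
    where
    solve : ∀ a q n → a + q * n + n ≡ a + (q + + 1) * n
    solve = solve-∀

  0≤quo⇒1≤ω : ∀ y → + 0 ℤ.≤ quo y → + 1 ℤ.≤ ω w y
  0≤quo⇒1≤ω y 0≤q with ≤⇒∃ 0≤q
  ... | k , e = subst (+ 1 ℤ.≤_) (trans (cong (λ z → + 1 + z) (sym ω-1≡)) (solve (ω w y))) (ℤ.+≤+ (s≤s z≤n))
    where
    solve : ∀ x → + 1 + (x - + 1) ≡ x
    solve = solve-∀
    ω-1≡ : ω w y - + 1 ≡ + (cls y ℕ.+ k ℕ.* n)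
    ω-1≡ = trans (ω-divMod y) (cong (λ z → + cls y + z)
      (trans (cong (_* + n) (trans e (ℤₚ.+-identityˡ (+ k)))) (sym (ℤₚ.pos-* k n))))

  1≤ω⇒0≤quo : ∀ y → + 1 ℤ.≤ ω w y → + 0 ℤ.≤ quo y
  1≤ω⇒0≤quo y 1≤ω = 0≤n⇒0≤n/ℕd (ω w y - + 1) n (ℤₚ.i≤j⇒0≤j-i 1≤ω)

  -- Equivalently 1 ≤ ω w y.
  InA : ℤ → Bool
  InA y = does (+ 0 ℤ.≤? quo y)

  InA-closed-n : ClosedUnder n InA
  InA-closed-n y y∈ = dec-true (+ 0 ℤ.≤? quo (y + + n)) (subst (+ 0 ℤ.≤_) (sym (quo-shift y))
    (ℤₚ.≤-trans (does-true⇒ (+ 0 ℤ.≤? quo y) y∈) (ℤₚ.i≤i+j (quo y) (+ 1))))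

  -- Adding `p` raises the value of `ω`, by stability, so a value of at least 1 stays so.
  InA-closed-p : ∀ {p} → Stable p w → ClosedUnder p InA
  InA-closed-p {p} st y y∈ = dec-true (+ 0 ℤ.≤? quo (y + + p)) (1≤ω⇒0≤quo (y + + p)
    (ℤₚ.≤-trans (0≤quo⇒1≤ω y (does-true⇒ (+ 0 ℤ.≤? quo y) y∈)) (ℤₚ.<⇒≤ (st y))))

  bᵢ : ℕ → ℤ
  bᵢ i = a i - + n

  bᵢ≡ : ∀ i → bᵢ i ≡ a i + -[1+ 0 ] * + n
  bᵢ≡ i = solve (a i) (+ n)
    where
    solve : ∀ a n → a - n ≡ a + (- + 1) * n
    solve = solve-∀

  a∈ : ∀ {i} → i < n → InA (a i) ≡ true
  a∈ {i} i<n = dec-true (+ 0 ℤ.≤? quo (a i))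
    (ℤₚ.≤-reflexive (sym (proj₂ (cls-quo-unique (+ 0) i<n (sym (ℤₚ.+-identityʳ (a i)))))))

  b-isGap : ∀ {i} → i < n → Gap n InA (bᵢ i)
  b-isGap {i} i<n = dec-false (+ 0 ℤ.≤? quo (bᵢ i)) (λ 0≤q → 0≰-1 (subst (+ 0 ℤ.≤_) (proj₂ (cls-quo-unique -[1+ 0 ] i<n (bᵢ≡ i))) 0≤q))
    , trans (cong InA (x-y+y (a i) (+ n))) (a∈ i<n)
    where
    0≰-1 : ¬ (+ 0 ℤ.≤ -[1+ 0 ])
    0≰-1 ()

  gap⇒bᵢ : ∀ {x} → Gap n InA x → ∃ λ i → i < n × x ≡ bᵢ i
  gap⇒bᵢ {x} (x∉ , x+n∈) = cls x , cls<n x ,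
    trans (y≡a+quo*n x) (trans (cong (λ q → a (cls x) + q * + n) quo≡) (sym (bᵢ≡ (cls x))))
    where
    minus-one : ∀ q → ¬ (+ 0 ℤ.≤ q) → + 0 ℤ.≤ q + + 1 → q ≡ -[1+ 0 ]
    minus-one (+ k)        0≰q _ = ⊥-elim (0≰q (ℤ.+≤+ z≤n))
    minus-one -[1+ zero ]  _   _ = refl
    minus-one -[1+ suc k ] _   ()
    quo≡ : quo x ≡ -[1+ 0 ]
    quo≡ = minus-one (quo x) (does-false⇒ (+ 0 ℤ.≤? quo x) x∉)
      (subst (+ 0 ℤ.≤_) (quo-shift x) (does-true⇒ (+ 0 ℤ.≤? quo (x + + n)) x+n∈))

  InA⇒≥ : ∀ {y} → + 0 ℤ.≤ quo y → a (cls y) ℤ.≤ y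
  InA⇒≥ {y} 0≤q = subst (a (cls y) ℤ.≤_) (sym (y≡a+quo*n y))
    (subst (ℤ._≤ a (cls y) + quo y * + n) (ℤₚ.+-identityʳ (a (cls y)))
      (ℤₚ.+-monoʳ-≤ (a (cls y)) (ℤₚ.*-monoʳ-≤-nonNeg (+ n) 0≤q)))

  ∉InA⇒< : ∀ {y} → ¬ (+ 0 ℤ.≤ quo y) → y ℤ.< a (cls y)
  ∉InA⇒< {y} 0≰q = subst (ℤ._< a (cls y)) (sym (y≡a+quo*n y))
    (subst (a (cls y) + quo y * + n ℤ.<_) (ℤₚ.+-identityʳ (a (cls y)))
      (ℤₚ.+-monoʳ-< (a (cls y)) (ℤₚ.*-monoʳ-<-pos (+ n) {{ℤ.positive (ℤ.+<+ 0<n)}} (ℤₚ.≰⇒> 0≰q))))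

  module _ (dom : Dominant w) where

    a-mono-< : ∀ {i j} → i < j → j < n → a i ℤ.< a j
    a-mono-< {i} {suc j} (s≤s i≤j) j<n with ℕₚ.m≤n⇒m<n∨m≡n i≤j
    ... | inj₁ i<j  = ℤₚ.<-trans (a-mono-< i<j (ℕₚ.<-trans ℕₚ.≤-refl j<n)) (dom (suc j) (s≤s z≤n) j<n)
    ... | inj₂ refl = dom (suc j) (s≤s z≤n) j<n

    a-mono-≤ : ∀ {i j} → i ≤ j → j < n → a i ℤ.≤ a j
    a-mono-≤ i≤j j<n with ℕₚ.m≤n⇒m<n∨m≡n i≤j
    ... | inj₁ i<j  = ℤₚ.<⇒≤ (a-mono-< i<j j<n)
    ... | inj₂ refl = ℤₚ.≤-refl

    -- No member lies below `a 0`, so the first window is empty. From one generator to the next the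
    -- count rises once, at `bᵢ i`, as no gap lies strictly between.
    b-isRank : ∀ {i} → i < n → window InA n (bᵢ i) ≡ i
    b-isRank {zero} 0<n = trans (∑-cong n λ k k<n → cong ⟦_⟧ (dec-false (+ 0 ℤ.≤? quo (bᵢ 0 + + k)) λ 0≤q →
      ℤₚ.<-irrefl refl (ℤₚ.<-≤-trans (below k k<n) (ℤₚ.≤-trans (a-mono-≤ z≤n (cls<n _)) (InA⇒≥ 0≤q))))) (∑-zero n)
      where
      below : ∀ k → k < n → bᵢ 0 + + k ℤ.< a 0
      below k k<n = subst (bᵢ 0 + + k ℤ.<_) (x-y+y (a 0) (+ n)) (ℤₚ.+-monoʳ-< (bᵢ 0) (ℤ.+<+ k<n))
    b-isRank {suc i} i+1<n with <⇒∃ (ℤₚ.+-monoˡ-< (- + n) (a-mono-< {i} {suc i} ℕₚ.≤-refl i+1<n))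
    ... | k , e = begin
      window InA n (bᵢ (suc i))             ≡⟨ window-cong InA n (trans e (sym (ℤₚ.+-assoc (bᵢ i) (+ 1) (+ k)))) ⟩
      window InA n (bᵢ i + + 1 + + k)       ≡⟨ window-no-gaps InA n (bᵢ i + + 1) InA-closed-n k none ⟩
      window InA n (bᵢ i + + 1)             ≡⟨ window-gap InA-closed-n (b-isGap i<n) ⟩
      suc (window InA n (bᵢ i))             ≡⟨ cong suc (b-isRank i<n) ⟩
      suc i                                 ∎
      where
      open ≡-Reasoning
      i<n : i < n
      i<n = ℕₚ.<-trans ℕₚ.≤-refl i+1<n
      none : ∀ m → m < k → ¬ Gap n InA (bᵢ i + + 1 + + m)
      none m m<k gap with gap⇒bᵢ gap
      ... | j , j<n , e′ with ℕₚ.≤-<-connex j i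
      ...   | inj₁ j≤i = ℤₚ.<-irrefl (sym (trans (sym (ℤₚ.+-assoc (bᵢ i) (+ 1) (+ m))) e′))
        (ℤₚ.≤-<-trans (ℤₚ.+-monoˡ-≤ (- + n) (a-mono-≤ j≤i i<n)) (∃⇒< (bᵢ i) m))
      ...   | inj₂ i<j = ℤₚ.<-irrefl (trans (sym (ℤₚ.+-assoc (bᵢ i) (+ 1) (+ m))) e′)
        (ℤₚ.<-≤-trans (subst (bᵢ i + + suc m ℤ.<_) (sym e) (ℤₚ.+-monoʳ-< (bᵢ i) (ℤ.+<+ (s≤s m<k))))
          (ℤₚ.+-monoˡ-≤ (- + n) (a-mono-≤ i<j j<n)))

    semimodule : ∀ {p} → Stable p w → Semimodule n p
    semimodule st = record
      { A        = InA
      ; closed-n = InA-closed-n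
      ; closed-p = InA-closed-p st
      ; b        = bᵢ
      ; b-gap    = b-isGap
      ; gap⇒b    = gap⇒bᵢ
      ; b-rank   = b-isRank
      }

-- Row and column sums of the tableau

module Tableau {n} .{{n≢0 : NonZero n}} (w : AffinePerm n) (dom : Dominant w) where

  open Perm w

  -- The residue of `a j - a i` is nonzero because the classes differ, so it is written `suc D`;
  -- then `D` itself is the remainder of `e` in the counts below.
  record Offset (i j : ℕ) : Set where
    constructor offset
    field
      D k  : ℕ
      sD<n : suc D < n
      eq   : a j ≡ a i + (+ suc D + + k * + n)

    D<n : D < n
    D<n = ℕₚ.<-trans ℕₚ.≤-refl sD<n

  a-offset : ∀ {i j} → i < j → j < n → Offset i j
  a-offset {i} {j} i<j j<n = make (x %ℕ n) (n%ℕd<d x n) (∣ x /ℕ n ∣)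
    (trans (a≡a%ℕn+[a/ℕn]*n x n) (cong (λ q → + (x %ℕ n) + q * + n)
      (sym (ℤₚ.0≤i⇒+∣i∣≡i (0≤n⇒0≤n/ℕd x n (ℤₚ.i≤j⇒0≤j-i (ℤₚ.<⇒≤ (a-mono-< dom i<j j<n))))))))
    where
    x = a j - a i
    y-x : ∀ y x → y ≡ x + (y - x)
    y-x = solve-∀
    make : ∀ d → d < n → ∀ k → x ≡ + d + + k * + n → Offset i j
    make (suc D) d<n k e = offset D k d<n (trans (y-x (a j) (a i)) (cong (λ z → a i + z) e))
    -- A zero remainder would put `a i` and `a j` into one class, although their indices differ.
    make zero    d<n k e = ⊥-elim (ℕₚ.<-irrefl (trans (sym (proj₁ (cls-quo-unique (+ k) i<n aj≡)))
      (proj₁ (cls-quo-unique (+ 0) j<n (sym (ℤₚ.+-identityʳ (a j)))))) i<j)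
      where
      i<n : i < n
      i<n = ℕₚ.<-trans i<j j<n
      aj≡ : a j ≡ a i + + k * + n
      aj≡ = trans (y-x (a j) (a i)) (cong (λ z → a i + z) (trans e (ℤₚ.+-identityˡ _)))

  kij-offset : ∀ {i j} (o : Offset i j) → kij n w (suc i) (suc j) ≡ Offset.k o
  kij-offset {i} {j} (offset D k sD<n eq) = cong ∣_∣ (proj₂ (divMod-≡ n (a j - a i) (+ k) sD<n
    (trans (cong (_- a i) eq) (solve (a i) _))))
    where
    solve : ∀ x y → x + y - x ≡ y
    solve = solve-∀

  sω-offset : ∀ {i j} (o : Offset i j) → let s = sω n w (suc i) ; t = sω n w (suc j) ; d = suc (Offset.D o) in
    t ≡ s ℕ.+ d ⊎ (t < s × t ℕ.+ n ≡ s ℕ.+ d)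
  sω-offset {i} {j} (offset D k sD<n eq) = by-cases (σ ℕ.+ suc D ℕ.<? n)
    where
    σ = (a i - + 1) %ℕ n
    q = (a i - + 1) /ℕ n
    aj-1≡ : a j - + 1 ≡ + σ + q * + n + (+ suc D + + k * + n)
    aj-1≡ = trans (cong (_- + 1) eq) (trans (+-right-comm (a i) _ (- + 1))
      (cong (_+ (+ suc D + + k * + n)) (a≡a%ℕn+[a/ℕn]*n (a i - + 1) n)))
    by-cases : Dec (σ ℕ.+ suc D < n) → _
    by-cases (yes lt) = inj₁ (cong suc (proj₁ (divMod-≡ n (a j - + 1) (q + + k) lt
      (trans aj-1≡ (solve (+ σ) q (+ n) (+ suc D) (+ k))))))
      where
      solve : ∀ s q n d k → s + q * n + (d + k * n) ≡ s + d + (q + k) * n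
      solve = solve-∀
    -- Wrap-around: `x` is the excess of `σ + suc D` over `n`, and is below `σ` because `suc D < n`.
    by-cases (no ≮) with ℕₚ.m≤n⇒∃[o]m+o≡n (ℕₚ.≮⇒≥ ≮)
    ... | x , n+x≡ = inj₂ (s≤s (subst (_< σ) (sym t≡) x<σ) , cong suc (trans (cong (ℕ._+ n) t≡) (trans (ℕₚ.+-comm x n) n+x≡)))
      where
      x<σ : x < σ
      x<σ = ℕₚ.+-cancelˡ-< n x σ (subst₂ _<_ (sym n+x≡) (ℕₚ.+-comm σ n) (ℕₚ.+-monoʳ-< σ sD<n))
      solve : ∀ s q n d k x → n + x ≡ s + d → s + q * n + (d + k * n) ≡ x + (q + k + + 1) * n
      solve s q n d k x e = trans (solve₁ s q n d k) (trans (cong (_+ (q + k) * n) (sym e)) (solve₂ q n k x))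
        where
        solve₁ : ∀ s q n d k → s + q * n + (d + k * n) ≡ s + d + (q + k) * n
        solve₁ = solve-∀
        solve₂ : ∀ q n k x → n + x + (q + k) * n ≡ x + (q + k + + 1) * n
        solve₂ = solve-∀
      t≡ : (a j - + 1) %ℕ n ≡ x
      t≡ = proj₁ (divMod-≡ n (a j - + 1) (q + + k + + 1) (ℕₚ.<-trans x<σ (n%ℕd<d (a i - + 1) n))
        (trans aj-1≡ (solve (+ σ) q (+ n) (+ suc D) (+ k) (+ x) (cong +_ n+x≡))))

  -- The cap is `m + 1` when `D < r` and `m` otherwise, which is the number of `e < p` with
  -- remainder `D`. Row and column counts both reduce to this sum.
  tp-offset : ∀ p {i j} (o : Offset i j) → tp n p w (suc i) (suc j) ≡
    ∑ p (λ e → ⟦ does (e ℕ./ n ℕ.<? Offset.k o) ∧ does (e ℕ.% n ℕ.≟ Offset.D o) ⟧)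
  tp-offset p {i} {j} o = begin
    tp n p w (suc i) (suc j)
      ≡⟨ cong₂ (λ β k → if β then k ℕ.⊓ m else k ℕ.⊓ suc m)
           (cap-condition n r (sω n w (suc i)) (sω n w (suc j)) D (sω-offset o)) (kij-offset o) ⟩
    (if not (does (D ℕ.<? r)) then k ℕ.⊓ m else k ℕ.⊓ suc m)
      ≡⟨ cap (does (D ℕ.<? r)) ⟩
    k ℕ.⊓ (m ℕ.+ ⟦ does (D ℕ.<? r) ⟧)
      ≡⟨ residue-count n D<n p k ⟨
    ∑ p (λ e → ⟦ does (e ℕ./ n ℕ.<? k) ∧ does (e ℕ.% n ℕ.≟ D) ⟧) ∎
    where
    open ≡-Reasoning
    open Offset o
    m = p ℕ./ n
    r = p ℕ.% n
    cap : ∀ β → (if not β then k ℕ.⊓ m else k ℕ.⊓ suc m) ≡ k ℕ.⊓ (m ℕ.+ ⟦ β ⟧)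
    cap true  = cong (k ℕ.⊓_) (ℕₚ.+-comm 1 m)
    cap false = cong (k ℕ.⊓_) (sym (ℕₚ.+-identityʳ m))

  private
    divMod-ℕ : ∀ {D} e q → D < n → + e ≡ + D + q * + n → e ℕ.% n ≡ D × + (e ℕ./ n) ≡ q
    divMod-ℕ e q D<n eq = divMod-≡ n (+ e) q D<n eq

  columnEntry : ℕ → ℕ → ℕ → ℕ
  columnEntry p j i = ∑ p (λ e → ⟦ InA (bᵢ j - + suc e) ∧ does (cls (bᵢ j - + suc e) ℕ.≟ i) ⟧)

  column-sum : ∀ p j → window InA p (bᵢ j - + p) ≡ ∑ n (columnEntry p j)
  column-sum p j = trans (window-down InA p (bᵢ j)) (∑-by-class n p _ _ (λ e → cls<n (bᵢ j - + suc e)))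

  -- Solving `y e = a i + l * n` gives `e = D + (k - 1 - l) * n`. So `e` has remainder `D`, and
  -- `l ≥ 0` says that its quotient is below `k`.
  columnEntry-< : ∀ p {i j} → i < j → j < n → columnEntry p j i ≡ tp n p w (suc i) (suc j)
  columnEntry-< p {i} {j} i<j j<n = trans (∑-cong p λ e _ → cong ⟦_⟧ (does-⇔ (mk⇔ (to e) (from e))
      ((+ 0 ℤ.≤? quo (y e)) ×-dec (cls (y e) ℕ.≟ i)) ((e ℕ./ n ℕ.<? k) ×-dec (e ℕ.% n ℕ.≟ D)))) (sym (tp-offset p o))
    where
    o = a-offset i<j j<n
    open Offset o
    y : ℕ → ℤ
    y e = bᵢ j - + suc e
    to : ∀ e → + 0 ℤ.≤ quo (y e) × cls (y e) ≡ i → e ℕ./ n < k × e ℕ.% n ≡ D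
    to e (0≤q , c≡i) with ≤⇒∃ 0≤q
    ... | l , q≡ = subst (e ℕ./ n <_) (ℤₚ.+-injective k≡) (ℕₚ.m<m+n _ (s≤s z≤n)) , proj₁ dm
      where
      solve : ∀ x n d k e a l → x - n - (+ 1 + e) ≡ a + (+ 0 + l) * n → x ≡ a + (+ 1 + d + k * n) →
        e ≡ d + (k - (+ 1 + l)) * n
      solve x n d k e a l h refl = trans (solve₁ n d k e a) (trans (cong (λ z → a + (d + k * n) - n - z) h) (solve₂ n d k a l))
        where
        solve₁ : ∀ n d k e a → e ≡ a + (d + k * n) - n - (a + (+ 1 + d + k * n) - n - (+ 1 + e))
        solve₁ = solve-∀
        solve₂ : ∀ n d k a l → a + (d + k * n) - n - (a + (+ 0 + l) * n) ≡ d + (k - (+ 1 + l)) * n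
        solve₂ = solve-∀
      dm = divMod-ℕ e (+ k - + suc l) D<n (solve (a j) (+ n) (+ D) (+ k) (+ e) (a i) (+ l)
        (trans (y≡a+quo*n (y e)) (cong₂ (λ c q → a c + q * + n) c≡i q≡)) eq)
      k≡ : + (e ℕ./ n ℕ.+ suc l) ≡ + k
      k≡ = trans (cong (_+ + suc l) (proj₂ dm)) (x-y+y (+ k) (+ suc l))
    from : ∀ e → e ℕ./ n < k × e ℕ.% n ≡ D → + 0 ℤ.≤ quo (y e) × cls (y e) ≡ i
    from e (lt , r≡) with ℕₚ.m≤n⇒∃[o]m+o≡n lt
    ... | l , k≡ = subst (+ 0 ℤ.≤_) (sym (proj₂ cq)) (ℤ.+≤+ z≤n) , proj₁ cq
      where
      solve : ∀ n d q a l → a + (+ 1 + d + (+ 1 + q + l) * n) - n - (+ 1 + (d + q * n)) ≡ a + l * n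
      solve = solve-∀
      e≡ : + e ≡ + D + + (e ℕ./ n) * + n
      e≡ = trans (a≡a%ℕn+[a/ℕn]*n (+ e) n) (cong (λ r → + r + + (e ℕ./ n) * + n) r≡)
      cq = cls-quo-unique (+ l) (ℕₚ.<-trans i<j j<n) (begin
        a j - + n - + suc e
          ≡⟨ cong₂ (λ x z → x - + n - (+ 1 + z)) eq e≡ ⟩
        a i + (+ suc D + + k * + n) - + n - (+ 1 + (+ D + + (e ℕ./ n) * + n))
          ≡⟨ cong (λ k → a i + (+ suc D + + k * + n) - + n - (+ 1 + (+ D + + (e ℕ./ n) * + n))) (sym k≡) ⟩
        a i + (+ suc D + + (suc (e ℕ./ n) ℕ.+ l) * + n) - + n - (+ 1 + (+ D + + (e ℕ./ n) * + n))
          ≡⟨ solve (+ n) (+ D) (+ (e ℕ./ n)) (a i) (+ l) ⟩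
        a i + + l * + n ∎)
        where open ≡-Reasoning

  -- Members of class `i` start at `a i`, which is at least `a j` and so above the whole window.
  columnEntry-≥ : ∀ p {i j} → j ≤ i → i < n → columnEntry p j i ≡ 0
  columnEntry-≥ p {i} {j} j≤i i<n = trans (∑-cong p λ e _ → cong ⟦_⟧
      (dec-false ((+ 0 ℤ.≤? quo (bᵢ j - + suc e)) ×-dec (cls (bᵢ j - + suc e) ℕ.≟ i)) (none e))) (∑-zero p)
    where
    none : ∀ e → ¬ (+ 0 ℤ.≤ quo (bᵢ j - + suc e) × cls (bᵢ j - + suc e) ≡ i)
    none e (0≤q , refl) = ℤₚ.<-irrefl refl (ℤₚ.<-≤-trans
      (ℤₚ.<-≤-trans (subst (bᵢ j - + suc e ℤ.<_) (x-y+y (bᵢ j) (+ suc e)) (∃⇒< (bᵢ j - + suc e) e)) (ℤₚ.i-j≤i (a j) (+ n)))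
      (ℤₚ.≤-trans (a-mono-≤ dom j≤i i<n) (InA⇒≥ 0≤q)))

  -- The window is (a i , a i + p] rather than [a i , a i + p) (both endpoints are in A), so that the
  -- residues counted are literally those of columnEntry.
  rowEntry : ℕ → ℕ → ℕ → ℕ
  rowEntry p i j = ∑ p (λ e → ⟦ not (InA (a i + + 1 + + e)) ∧ does (cls (a i + + 1 + + e) ℕ.≟ j) ⟧)

  -- A row counts the non-members in the window, hence the complement in `p`. Sliding the window by
  -- one does not change the count of members, since `a i` is not a gap.
  row-sum : ∀ {p} → Stable p w → ∀ {i} → i < n → window InA p (a i) ℕ.+ ∑ n (rowEntry p i) ≡ p
  row-sum {p} st {i} i<n = trans (cong₂ ℕ._+_ (sym slide)
      (sym (∑-by-class n p _ _ (λ e → cls<n (a i + + 1 + + e))))) (∑-not p (λ e → InA (a i + + 1 + + e)))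
    where
    slide : window InA p (a i + + 1) ≡ window InA p (a i)
    slide = window-no-gap InA p (a i) (InA-closed-p st) λ gap → true≢false (trans (sym (a∈ i<n)) (proj₁ gap))

  -- Solving `y e = a j + q * n` gives `e = D + (k + q) * n`. Non-membership means `q < 0`, that is,
  -- a quotient of `e` below `k`.
  rowEntry-< : ∀ p {i j} → i < j → j < n → rowEntry p i j ≡ tp n p w (suc i) (suc j)
  rowEntry-< p {i} {j} i<j j<n = trans (∑-cong p λ e _ → cong ⟦_⟧ (does-⇔ (mk⇔ (to e) (from e))
      (¬? (+ 0 ℤ.≤? quo (y e)) ×-dec (cls (y e) ℕ.≟ j)) ((e ℕ./ n ℕ.<? k) ×-dec (e ℕ.% n ℕ.≟ D)))) (sym (tp-offset p o))
    where
    o = a-offset i<j j<n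
    open Offset o
    y : ℕ → ℤ
    y e = a i + + 1 + + e
    to : ∀ e → ¬ (+ 0 ℤ.≤ quo (y e)) × cls (y e) ≡ j → e ℕ./ n < k × e ℕ.% n ≡ D
    to e (0≰q , c≡j) with <⇒∃ (ℤₚ.≰⇒> 0≰q)
    ... | l , q≡ = subst (e ℕ./ n <_) (ℤₚ.+-injective k≡) (ℕₚ.m<m+n _ (s≤s z≤n)) , proj₁ dm
      where
      solve : ∀ x n d k e a q → a + + 1 + e ≡ x + q * n → x ≡ a + (+ 1 + d + k * n) →
        e ≡ d + (k + q) * n
      solve x n d k e a q h refl = trans (solve₁ a e) (trans (cong (λ z → z - a - + 1) h) (solve₂ n d k a q))
        where
        solve₁ : ∀ a e → e ≡ a + + 1 + e - a - + 1
        solve₁ = solve-∀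
        solve₂ : ∀ n d k a q → a + (+ 1 + d + k * n) + q * n - a - + 1 ≡ d + (k + q) * n
        solve₂ = solve-∀
      dm = divMod-ℕ e (+ k + quo (y e)) D<n (solve (a j) (+ n) (+ D) (+ k) (+ e) (a i) (quo (y e))
        (trans (y≡a+quo*n (y e)) (cong (λ c → a c + quo (y e) * + n) c≡j)) eq)
      k≡ : + (e ℕ./ n ℕ.+ suc l) ≡ + k
      k≡ = trans (cong (_+ + suc l) (proj₂ dm)) (trans (ℤₚ.+-assoc (+ k) (quo (y e)) (+ suc l))
        (trans (cong (λ z → + k + z) (sym q≡)) (ℤₚ.+-identityʳ (+ k))))
    from : ∀ e → e ℕ./ n < k × e ℕ.% n ≡ D → ¬ (+ 0 ℤ.≤ quo (y e)) × cls (y e) ≡ j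
    from e (lt , r≡) with ℕₚ.m≤n⇒∃[o]m+o≡n lt
    ... | l , k≡ = (λ 0≤q → 0≰neg (subst (+ 0 ℤ.≤_) (proj₂ cq) 0≤q)) , proj₁ cq
      where
      0≰neg : ¬ (+ 0 ℤ.≤ -[1+ l ])
      0≰neg ()
      solve : ∀ n d q a l → a + + 1 + (d + q * n) ≡ a + (+ 1 + d + (+ 1 + q + l) * n) + (- (+ 1 + l)) * n
      solve = solve-∀
      e≡ : + e ≡ + D + + (e ℕ./ n) * + n
      e≡ = trans (a≡a%ℕn+[a/ℕn]*n (+ e) n) (cong (λ r → + r + + (e ℕ./ n) * + n) r≡)
      cq = cls-quo-unique -[1+ l ] j<n (begin
        a i + + 1 + + e
          ≡⟨ cong (λ z → a i + + 1 + z) e≡ ⟩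
        a i + + 1 + (+ D + + (e ℕ./ n) * + n)
          ≡⟨ solve (+ n) (+ D) (+ (e ℕ./ n)) (a i) (+ l) ⟩
        a i + (+ suc D + + (suc (e ℕ./ n) ℕ.+ l) * + n) + -[1+ l ] * + n
          ≡⟨ cong (λ k → a i + (+ suc D + + k * + n) + -[1+ l ] * + n) k≡ ⟩
        a i + (+ suc D + + k * + n) + -[1+ l ] * + n
          ≡⟨ cong (_+ -[1+ l ] * + n) (sym eq) ⟩
        a j + -[1+ l ] * + n ∎)
        where open ≡-Reasoning

  -- Non-members of class `j` lie below `a j`, which is at most `a i`, hence before the window.
  rowEntry-≥ : ∀ p {i j} → j ≤ i → i < n → rowEntry p i j ≡ 0
  rowEntry-≥ p {i} {j} j≤i i<n = trans (∑-cong p λ e _ → cong ⟦_⟧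
      (dec-false (¬? (+ 0 ℤ.≤? quo (y e)) ×-dec (cls (y e) ℕ.≟ j)) (none e))) (∑-zero p)
    where
    y : ℕ → ℤ
    y e = a i + + 1 + + e
    none : ∀ e → ¬ (¬ (+ 0 ℤ.≤ quo (y e)) × cls (y e) ≡ j)
    none e (0≰q , refl) = ℤₚ.<-irrefl refl (ℤₚ.<-trans
      (subst (a i ℤ.<_) (sym (ℤₚ.+-assoc (a i) (+ 1) (+ e))) (∃⇒< (a i) e))
      (ℤₚ.<-≤-trans (∉InA⇒< 0≰q) (a-mono-≤ dom j≤i i<n)))

-- From equal tableaux to equal row and column counts.

module _ {n p} .{{n≢0 : NonZero n}} (w w′ : AffinePerm n) (dom : Dominant w) (dom′ : Dominant w′)
  (st : Stable p w) (st′ : Stable p w′)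
  (tp≡ : ∀ (i j : ℕ) → 1 ≤ i → i < j → j ≤ n → tp n p w i j ≡ tp n p w′ i j) where

  private
    module P  = Perm w
    module P′ = Perm w′
    module T  = Tableau w dom
    module T′ = Tableau w′ dom′

    column-≡ : ∀ {j} → j < n → ∀ i → i < n → T.columnEntry p j i ≡ T′.columnEntry p j i
    column-≡ {j} j<n i i<n with ℕₚ.≤-<-connex j i
    ... | inj₁ j≤i = trans (T.columnEntry-≥ p j≤i i<n) (sym (T′.columnEntry-≥ p j≤i i<n))
    ... | inj₂ i<j = trans (T.columnEntry-< p i<j j<n)
      (trans (tp≡ (suc i) (suc j) (s≤s z≤n) (s≤s i<j) j<n) (sym (T′.columnEntry-< p i<j j<n)))

    row-≡ : ∀ {i} → i < n → ∀ j → j < n → T.rowEntry p i j ≡ T′.rowEntry p i j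
    row-≡ {i} i<n j j<n with ℕₚ.≤-<-connex j i
    ... | inj₁ j≤i = trans (T.rowEntry-≥ p j≤i i<n) (sym (T′.rowEntry-≥ p j≤i i<n))
    ... | inj₂ i<j = trans (T.rowEntry-< p i<j j<n)
      (trans (tp≡ (suc i) (suc j) (s≤s z≤n) (s≤s i<j) j<n) (sym (T′.rowEntry-< p i<j j<n)))

  -- Entries on or below the diagonal vanish for both permutations, and the others are tableau
  -- entries. The row counts follow by cancelling equal complements in `p`.
  tableau-agree : Agree (P.semimodule dom st) (P′.semimodule dom′ st′)
  tableau-agree = record
    { column = λ {j} j<n → trans (T.column-sum p j) (trans (∑-cong n (column-≡ j<n)) (sym (T′.column-sum p j)))
    ; row    = λ {i} i<n → trans (window-cong P.InA p (x-y+y (P.a i) (+ n)))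
        (trans (window-≡ i<n) (window-cong P′.InA p (sym (x-y+y (P′.a i) (+ n)))))
    }
    where
    window-≡ : ∀ {i} → i < n → window P.InA p (P.a i) ≡ window P′.InA p (P′.a i)
    window-≡ {i} i<n = ℕₚ.+-cancelʳ-≡ (∑ n (T.rowEntry p i)) _ _ (trans (T.row-sum st i<n)
      (trans (sym (T′.row-sum st′ i<n)) (cong (window P′.InA p (P′.a i) ℕ.+_) (sym (∑-cong n (row-≡ i<n))))))

-- Integer sums over initial segments.

sumUpTo : ℕ → (ℕ → ℤ) → ℤ
sumUpTo m f = sumℤ (applyUpTo f m)

sumUpTo-cong : ∀ m {f g : ℕ → ℤ} → (∀ k → f k ≡ g k) → sumUpTo m f ≡ sumUpTo m g
sumUpTo-cong zero    f≗g = refl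
sumUpTo-cong (suc m) f≗g = cong₂ _+_ (f≗g 0) (sumUpTo-cong m (f≗g ∘ suc))

sumUpTo-last : ∀ m f → sumUpTo (suc m) f ≡ sumUpTo m f + f m
sumUpTo-last zero    f = ℤₚ.+-comm (f 0) (+ 0)
sumUpTo-last (suc m) f = trans (cong (λ z → f 0 + z) (sumUpTo-last m (f ∘ suc))) (sym (ℤₚ.+-assoc (f 0) _ _))

-- The normalisation of the sum excludes translations

module _ {n} (w : AffinePerm n) where

  private
    periodSum : ℤ → ℤ
    periodSum c = sumUpTo n (λ k → ω w (c + + suc k))

    -- The slide replaces the first term by the one `n` places later, which periodicity makes larger
    -- by `n`.
    periodSum-suc : ∀ c → periodSum (c + + 1) ≡ periodSum c + + n
    periodSum-suc c = begin
      periodSum (c + + 1)                      ≡⟨ sumUpTo-cong n (λ k → cong (ω w) (ℤₚ.+-assoc c (+ 1) (+ suc k))) ⟩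
      sumUpTo n (f ∘ suc)                      ≡⟨ solve₁ (f 0) _ ⟩
      sumUpTo (suc n) f - f 0                  ≡⟨ cong (_- f 0) (sumUpTo-last n f) ⟩
      periodSum c + f n - f 0                  ≡⟨ cong (λ z → periodSum c + z - f 0) fn ⟩
      periodSum c + (f 0 + + n) - f 0          ≡⟨ solve₂ (periodSum c) (f 0) (+ n) ⟩
      periodSum c + + n                        ∎
      where
      open ≡-Reasoning
      f : ℕ → ℤ
      f k = ω w (c + + suc k)
      fn : f n ≡ f 0 + + n
      fn = trans (cong (ω w) (sym (ℤₚ.+-assoc c (+ 1) (+ n)))) (periodic w (c + + 1))
      solve₁ : ∀ x y → y ≡ x + y - x
      solve₁ = solve-∀
      solve₂ : ∀ s x n → s + (x + n) - x ≡ s + n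
      solve₂ = solve-∀

    periodSum-shift-ℕ : ∀ c k → periodSum (c + + k) ≡ periodSum c + + k * + n
    periodSum-shift-ℕ c zero    = trans (cong periodSum (ℤₚ.+-identityʳ c)) (sym (ℤₚ.+-identityʳ _))
    periodSum-shift-ℕ c (suc k) = begin
      periodSum (c + + suc k)             ≡⟨ cong periodSum (solve₁ c (+ k)) ⟩
      periodSum (c + + k + + 1)           ≡⟨ periodSum-suc (c + + k) ⟩
      periodSum (c + + k) + + n           ≡⟨ cong (_+ + n) (periodSum-shift-ℕ c k) ⟩
      periodSum c + + k * + n + + n       ≡⟨ solve₂ (periodSum c) (+ k) (+ n) ⟩
      periodSum c + + suc k * + n         ∎
      where
      open ≡-Reasoning
      solve₁ : ∀ c k → c + (+ 1 + k) ≡ c + k + + 1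
      solve₁ = solve-∀
      solve₂ : ∀ s k n → s + k * n + n ≡ s + (+ 1 + k) * n
      solve₂ = solve-∀

    periodSum-shift : ∀ c l → periodSum (c + l) ≡ periodSum c + l * + n
    periodSum-shift c (+ k)    = periodSum-shift-ℕ c k
    periodSum-shift c -[1+ k ] = begin
      periodSum d                                 ≡⟨ solve (periodSum d) (+ suc k) (+ n) ⟩
      periodSum d + + suc k * + n + -[1+ k ] * + n ≡⟨ cong (_+ -[1+ k ] * + n) (periodSum-shift-ℕ d (suc k)) ⟨
      periodSum (d + + suc k) + -[1+ k ] * + n    ≡⟨ cong (λ z → periodSum z + -[1+ k ] * + n) (x-y+y c (+ suc k)) ⟩
      periodSum c + -[1+ k ] * + n                ∎
      where
      open ≡-Reasoning
      d = c + -[1+ k ]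
      solve : ∀ s k n → s ≡ s + k * n + (- k) * n
      solve = solve-∀

  -- Shifting the period by `δ` adds `δ * + n` to the sum, while both permutations have the same
  -- prescribed sum.
  translation-trivial : .{{_ : NonZero n}} (w′ : AffinePerm n) (δ : ℤ) → (∀ x → ω w′ x ≡ ω w (x + δ)) → δ ≡ + 0
  translation-trivial w′ δ h = ℤₚ.*-cancelʳ-≡ δ (+ 0) (+ n) (begin
    δ * + n                                   ≡⟨ solve (periodSum (+ 0)) (δ * + n) ⟩
    periodSum (+ 0) + δ * + n - periodSum (+ 0) ≡⟨ cong (_- periodSum (+ 0)) (trans (sym (periodSum-shift (+ 0) δ)) sums) ⟩
    periodSum (+ 0) - periodSum (+ 0)         ≡⟨ ℤₚ.+-inverseʳ (periodSum (+ 0)) ⟩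
    + 0                                       ∎)
    where
    open ≡-Reasoning
    solve : ∀ s x → x ≡ s + x - s
    solve = solve-∀
    solve′ : ∀ δ k → + 0 + δ + k ≡ k + δ
    solve′ = solve-∀
    total : ∀ (v : AffinePerm n) → sumUpTo n (λ k → ω v (+ suc k)) ≡ + ((n ℕ.* suc n) ℕ./ 2)
    total v = trans (cong sumℤ (sym (map-upTo (λ k → ω v (+ suc k)) n))) (sum-cond v)
    sums : periodSum (+ 0 + δ) ≡ periodSum (+ 0)
    sums = begin
      periodSum (+ 0 + δ)                   ≡⟨ sumUpTo-cong n (λ k → trans (cong (ω w) (solve′ δ (+ suc k))) (sym (h (+ suc k)))) ⟩
      sumUpTo n (λ k → ω w′ (+ suc k))      ≡⟨ trans (total w′) (sym (total w)) ⟩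
      periodSum (+ 0)                       ∎

-- Recovery of a permutation from its generators.

theorem2p14 : (n p : ℕ) .{{_ : NonZero n}} → 1 ≤ p → Coprime n p →
    (w w′ : AffinePerm n) →
    Dominant w → Stable p w → Dominant w′ → Stable p w′ →
    (∀ (i j : ℕ) → 1 ≤ i → i < j → j ≤ n → tp n p w i j ≡ tp n p w′ i j) →
    ∀ (x : ℤ) → ω w x ≡ ω w′ x
theorem2p14 n p _ cop w w′ dom st dom′ st′ tp≡ x =
  trans (ω≡ x) (cong (ω w′) (trans (cong (λ z → x + z) (translation-trivial w′ w δ ω≡)) (ℤₚ.+-identityʳ x)))
  where
  module P  = Perm w
  module P′ = Perm w′
  -- The displacement between the two lists of generators, read off at index 0.
  δ = P′.bᵢ 0 - P.bᵢ 0
  solve₁ : ∀ a n q δ → a - n + δ + n + q ≡ a + q + δ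
  solve₁ = solve-∀
  b≡ : ∀ {i} → i < n → P′.bᵢ i ≡ P.bᵢ i + δ
  b≡ = agree⇒translate (tableau-agree w w′ dom dom′ st st′ tp≡) cop
  -- Each permutation sends its own generator `a c` to `+ suc c`, and these generators differ by
  -- `δ`; periodicity extends the comparison to `x = a c + q * n`.
  ω≡ : ∀ x → ω w x ≡ ω w′ (x + δ)
  ω≡ x = sym (begin
    ω w′ (x + δ)                        ≡⟨ cong (λ z → ω w′ (z + δ)) (P.y≡a+quo*n x) ⟩
    ω w′ (P.a c + q * + n + δ)          ≡⟨ cong (ω w′) (solve₁ (P.a c) (+ n) (q * + n) δ) ⟨
    ω w′ (P.bᵢ c + δ + + n + q * + n)   ≡⟨ cong (λ z → ω w′ (z + + n + q * + n)) (b≡ (P.cls<n x)) ⟨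
    ω w′ (P′.bᵢ c + + n + q * + n)      ≡⟨ cong (λ z → ω w′ (z + q * + n)) (x-y+y (P′.a c) (+ n)) ⟩
    ω w′ (P′.a c + q * + n)             ≡⟨ P′.ω-shift (P′.a c) q ⟩
    ω w′ (P′.a c) + q * + n             ≡⟨ cong (_+ q * + n) (trans (inv-right w′ (+ suc c)) (sym (inv-right w (+ suc c)))) ⟩
    ω w (P.a c) + q * + n               ≡⟨ P.ω-shift (P.a c) q ⟨
    ω w (P.a c + q * + n)               ≡⟨ cong (ω w) (P.y≡a+quo*n x) ⟨
    ω w x                               ∎)
    where
    open ≡-Reasoning
    c = P.cls x
    q = P.quo x
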